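{- The problems LBHom and LIHom can be solved in polynomial time when $G$ has bounded treewidth and $G$ or $H$ has bounded maximum degree. That is, for all constants $t$ and $d$, there are polynomial-time algorithms that decide, for given graphs $G$ and $H$ such that $G$ has treewidth at most $t$ and at least one of $G$, $H$ has maximum degree at most $d$, whether there exists a locally bijective homomorphism from $G$ to $H$, and whether there exists a locally injective homomorphism from $G$ to $H$, respectively.
   Context: All graphs are finite, undirected, and have neither self-loops nor multiple edges. For a graph $G=(V_G,E_G)$ and $u\in V_G$, let $N_G(u)=\{v\in V_G : uv\in E_G\}$; the maximum degree of $G$ is $\max_{u\in V_G}|N_G(u)|$. A homomorphism from $G$ to $H$ is a mapping $\varphi:V_G\to V_H$ with $\varphi(u)\varphi(v)\in E_H$ whenever $uv\in E_G$. It is locally injective (respectively locally bijective) if for every $u\in V_G$ the restriction of $\varphi$ to $N_G(u)$, viewed as a mapping $N_G(u)\to N_H(\varphi(u))$, is injective (respectively bijective). LBHom and LIHom are the decision problems that take as input two graphs $G$ and $H$ (both part of the input) and ask whether there exists a homomorphism from $G$ to $H$ that is locally bijective or locally injective, respectively. A tree decomposition of $G$ is a tree $T$ whose nodes are subsets of $V_G$ such that: (1) each vertex of $G$ lies in some node; (2) for each edge $uv\in E_G$ some node contains both $u$ and $v$; (3) for each $v\in V_G$, the nodes containing $v$ induce a connected subtree of $T$. Its width is the size of a largest node minus one. The treewidth of $G$ is the minimum width over all tree decompositions of $G$. -}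

module Defs where

open import Data.Bool using (Bool; true; false; T)
open import Data.Fin using (Fin; zero; suc; inject₁; fromℕ)
open import Data.Fin.Subset using (Subset; _∈_; ∣_∣)
open import Data.Integer as ℤ using (ℤ; +_)
open import Data.List as List using (List; []; _∷_; _++_)
open import Data.List.Extrema.Nat using (max)
open import Data.Nat using (ℕ; suc; _+_; _*_; _^_; _≤_; NonZero)
open import Data.Product using (Σ; Σ-syntax; ∃; ∃-syntax; _×_; _,_; proj₁; proj₂)
open import Data.Sum using (_⊎_)
open import Data.Unit using (⊤)
open import Data.Vec as Vec using (Vec; _∷_; lookup; _[_]%=_)
open import Function.Definitions using (Injective; Bijective)
open import Relation.Binary.Construct.Closure.ReflexiveTransitive using (Star)
open import Relation.Binary.PropositionalEquality using (_≡_)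
open import Relation.Nullary using (¬_; Reflects)

record Graph : Set where
  field
    order  : ℕ
    adj    : Fin order → Fin order → Bool
    symm   : ∀ u v → adj u v ≡ adj v u
    noLoop : ∀ u → adj u u ≡ false

open Graph public

Vertex : Graph → Set
Vertex G = Fin (order G)

Adj : (G : Graph) → Vertex G → Vertex G → Set
Adj G u v = T (adj G u v)

-- The neighbourhood as a finite set (to be counted) and as a type (to be
-- the domain of a map); `T b` has at most one element, so propositional
-- equality on `Nbr G u` is equality of the underlying vertices.

N : (G : Graph) → Vertex G → Subset (order G)
N G u = Vec.tabulate (adj G u)

Nbr : (G : Graph) → Vertex G → Set
Nbr G u = ∃[ v ] Adj G u v

maximum : ∀ {n} → (Fin n → ℕ) → ℕ
maximum f = max 0 (List.tabulate f)

maxDegree : Graph → ℕ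
maxDegree G = maximum (λ u → ∣ N G u ∣)

record Hom (G H : Graph) : Set where
  field
    map      : Vertex G → Vertex H
    preserve : ∀ {u v} → Adj G u v → Adj H (map u) (map v)

  restrict : ∀ u → Nbr G u → Nbr H (map u)
  restrict u (v , uv) = map v , preserve uv

LocallyInjective : ∀ {G H} → Hom G H → Set
LocallyInjective φ = ∀ u → Injective _≡_ _≡_ (Hom.restrict φ u)

LocallyBijective : ∀ {G H} → Hom G H → Set
LocallyBijective φ = ∀ u → Bijective _≡_ _≡_ (Hom.restrict φ u)

LIHom : Graph × Graph → Set
LIHom (G , H) = Σ[ φ ∈ Hom G H ] LocallyInjective φ

LBHom : Graph × Graph → Set
LBHom (G , H) = Σ[ φ ∈ Hom G H ] LocallyBijective φ

-- Connectedness of the subgraph induced by P.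
ConnectedOn : (G : Graph) → (Vertex G → Set) → Set
ConnectedOn G P =
  ∀ u v → P u → P v → Star (λ x y → P x × Adj G x y × P y) u v

record Cycle (G : Graph) : Set where
  field
    k        : ℕ
    at       : Fin (3 + k) → Vertex G
    distinct : Injective _≡_ _≡_ at
    step     : ∀ i → Adj G (at (inject₁ i)) (at (suc i))
    close    : Adj G (at (fromℕ (2 + k))) (at zero)

record IsTree (T : Graph) : Set where
  field
    nonempty  : NonZero (order T)
    connected : ConnectedOn T (λ _ → ⊤)
    acyclic   : ¬ Cycle T

-- Nodes are subsets of the vertex set rather than labelled by them, hence
-- `bag-injective`.
record TreeDecomposition (G : Graph) : Set where
  field
    tree            : Graph
    isTree          : IsTree tree
    bag             : Vertex tree → Subset (order G)
    bag-injective   : Injective _≡_ _≡_ bag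
    covers-vertices : ∀ v → ∃[ i ] v ∈ bag i
    covers-edges    : ∀ u v → Adj G u v → ∃[ i ] (u ∈ bag i × v ∈ bag i)
    connected       : ∀ v → ConnectedOn tree (λ i → v ∈ bag i)

-- Integer-valued: the empty graph has treewidth -1.
width : ∀ {G} → TreeDecomposition G → ℤ
width D = ℤ.pred (+ maximum (λ i → ∣ bag i ∣))
  where open TreeDecomposition D

record IsTreewidth (G : Graph) (w : ℤ) : Set where
  field
    attained : Σ[ D ∈ TreeDecomposition G ] width D ≡ w
    minimal  : (D : TreeDecomposition G) → w ℤ.≤ width D

TreewidthAtMost : ℕ → Graph → Set
TreewidthAtMost t G = ∃[ w ] (IsTreewidth G w × w ℤ.≤ + t)

-- Machine model: structured programs over k stacks of bits, where every
-- elementary operation reads or writes the top of one stack and costs one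
-- step.  A Turing-machine tape is a pair of stacks, and a stack is a tape
-- whose head stays at its end, so running times here and on multi-tape
-- Turing machines agree up to a constant factor.

data Program (k : ℕ) : Set where
  skip  : Program k
  push  : Fin k → Bool → Program k
  pop   : Fin k → Program k
  _⨾_   : Program k → Program k → Program k
  -- branches for: empty stack, top is false, top is true
  case  : Fin k → (ifEmpty ifFalse ifTrue : Program k) → Program k
  -- loops as long as the stack is nonempty, whatever its top bit
  while : Fin k → Program k → Program k

infixr 5 _⨾_

Store : ℕ → Set
Store k = Vec (List Bool) k

-- `p ∣ σ ⇓[ n ] τ`: started in σ, program p halts in τ after n steps.
-- The rules are deterministic.
data _∣_⇓[_]_ {k : ℕ} : Program k → Store k → ℕ → Store k → Set where

  ⇓skip : ∀ {σ} → skip ∣ σ ⇓[ 1 ] σ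

  ⇓push : ∀ {σ r b} → push r b ∣ σ ⇓[ 1 ] (σ [ r ]%= (b ∷_))

  -- no effect on an empty stack
  ⇓pop : ∀ {σ r} → pop r ∣ σ ⇓[ 1 ] (σ [ r ]%= List.drop 1)

  ⇓seq : ∀ {p q σ τ υ m n} →
         p ∣ σ ⇓[ m ] τ → q ∣ τ ⇓[ n ] υ → (p ⨾ q) ∣ σ ⇓[ m + n ] υ

  ⇓caseEmpty : ∀ {r p q s σ τ n} → lookup σ r ≡ [] →
               p ∣ σ ⇓[ n ] τ → case r p q s ∣ σ ⇓[ suc n ] τ

  ⇓caseFalse : ∀ {r p q s σ τ n bs} → lookup σ r ≡ false ∷ bs →
               q ∣ σ ⇓[ n ] τ → case r p q s ∣ σ ⇓[ suc n ] τ

  ⇓caseTrue : ∀ {r p q s σ τ n bs} → lookup σ r ≡ true ∷ bs →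
              s ∣ σ ⇓[ n ] τ → case r p q s ∣ σ ⇓[ suc n ] τ

  ⇓whileDone : ∀ {r p σ} → lookup σ r ≡ [] → while r p ∣ σ ⇓[ 1 ] σ

  ⇓whileStep : ∀ {r p σ τ υ m n b bs} → lookup σ r ≡ b ∷ bs →
               p ∣ σ ⇓[ m ] τ → while r p ∣ τ ⇓[ n ] υ →
               while r p ∣ σ ⇓[ suc (m + n) ] υ

-- The input is on stack 0 with its first bit on top, the others are empty.
initial : ∀ {k} → List Bool → Store (suc k)
initial {k} w = w ∷ Vec.replicate k []

-- The verdict is the top of stack 0 upon halting.
_Outputs_ : ∀ {k} → Store (suc k) → Bool → Set
σ Outputs b = ∃[ bs ] lookup σ zero ≡ b ∷ bs

-- Polynomial-time decidability of a promise problem: on every input that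
-- satisfies the promise, one fixed program halts with the correct answer
-- within c · (ℓ + 1)^e steps, ℓ being the length of the encoded input.

PolyTimeDecidable : {A : Set} (encode : A → List Bool)
                    (Promise Yes : A → Set) → Set
PolyTimeDecidable {A} encode Promise Yes =
  ∃[ k ] Σ[ p ∈ Program (suc k) ] ∃[ c ] ∃[ e ]
    ((x : A) → Promise x →
      ∃[ n ] ∃[ τ ] ∃[ b ]
        ( p ∣ initial (encode x) ⇓[ n ] τ
        × n ≤ c * suc (List.length (encode x)) ^ e
        × τ Outputs b
        × Reflects (Yes x) b ))

-- The number of vertices in unary, a terminating 0, and the rows of the
-- adjacency matrix; this is self-delimiting, so pairs are concatenated.

encodeGraph : Graph → List Bool
encodeGraph G =
  List.replicate (order G) true ++
  false ∷ List.concat (List.tabulate (λ u → List.tabulate (adj G u)))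

encodePair : Graph × Graph → List Bool
encodePair (G , H) = encodeGraph G ++ encodeGraph H

BoundedInstance : (t d : ℕ) → Graph × Graph → Set
BoundedInstance t d (G , H) =
  TreewidthAtMost t G × (maxDegree G ≤ d ⊎ maxDegree H ≤ d)

{-# OPTIONS --safe #-}
module Submission where

-- A locally injective homomorphism does not decrease degrees, so an instance
-- in which some vertex of G has degree above d is rejected at once; otherwise
-- every closed neighbourhood in G has at most d + 1 vertices.  A map from G to
-- H is a solution iff it satisfies a binary constraint on each pair of vertices
-- inside a closed neighbourhood, and the neighbourhoods of the bags of a tree
-- decomposition contain all these pairs and have at most κ = (t + 1)(d + 1)
-- vertices.  Hence it suffices to make all κ-tuples pairwise consistent: a
-- partial solution on a tuple is deleted as long as it is compatible with no
-- surviving partial solution on some other tuple.  If every tuple keeps a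
-- partial solution, a global one is assembled along the tree, the only place
-- where the decomposition is used: the algorithm never computes one.
--
-- The deletion is the iteration of a first-order definable operator on a table
-- of polynomial size.  Formulas turn into arithmetic expressions with bounded
-- sums, whose stack programs run in polynomial time since sums nest to a fixed
-- depth and all values are polynomially bounded.

open import Defs
open import Data.Bool using (Bool; true; false; T; if_then_else_)
open import Data.Bool.Properties using (T?; T-irrelevant)
open import Data.Empty using (⊥; ⊥-elim)
open import Data.Fin as Fin using (Fin; zero; suc; toℕ; fromℕ; fromℕ<; inject₁; punchIn; combine; remQuot)
open import Data.Fin.Patterns
open import Data.Fin.Properties as Finₚ using (any?; toℕ<n; toℕ-fromℕ<; toℕ-injective; remQuot-combine)
open import Data.Fin.Subset as Subset using (Subset; ⁅_⁆; _∪_; ∣_∣)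
  renaming (_∈_ to _∈ˢ_; _∉_ to _∉ˢ_; _⊂_ to _⊂ˢ_; _-_ to _-ˢ_)
open import Data.Fin.Subset.Induction using (⊃-wellFounded; Acc; acc)
open import Data.Fin.Subset.Properties
  using (x∈p∪q⁺; x∈p∪q⁻; x∈⁅x⁆; x∈⁅y⁆⇒x≡y; p⊆p∪q; _∈?_; x∈p⇒∣p-x∣<∣p∣; x∈p∧x≢y⇒x∈p-y)
import Data.Integer as ℤ
open import Data.List as List using (List; []; _∷_; _++_; length; _ʳ++_)
open import Data.List.Extrema.Nat using (v≤max⁺)
import Data.List.Membership.DecPropositional as DecMembership
open import Data.List.Membership.Propositional using (_∈_)
open import Data.List.Membership.Propositional.Properties using (∈-lookup)
open import Data.List.Properties
  using (++-assoc; ++-identityʳ; length-++; length-replicate; length-tabulate; length-ʳ++; ʳ++-ʳ++)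
open import Data.List.Relation.Unary.All as All using (All; []; _∷_)
open import Data.List.Relation.Unary.All.Properties using (¬Any⇒All¬)
open import Data.List.Relation.Unary.AllPairs using ([]; _∷_)
open import Data.List.Relation.Unary.Any using (here; there)
import Data.List.Relation.Unary.Any.Properties as Any
open import Data.List.Relation.Unary.Unique.Propositional using (Unique)
open import Data.Nat
open import Data.Nat.DivMod using (m≡m%n+[m/n]*n; m%n<n)
open import Data.Nat.Properties
open import Data.Product using (Σ-syntax; ∃-syntax; _×_; _,_; proj₁; proj₂)
open import Data.Sum using (_⊎_; inj₁; inj₂)
open import Data.Unit using (⊤; tt)
open import Data.Vec as Vec using (Vec; []; _∷_; here; there; lookup; updateAt; insertAt; replicate; _[_]%=_)
open import Data.Vec.Properties using (insertAt-punchIn; lookup∘tabulate; lookup⇒[]=; []=⇒lookup)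
open import Function using (_∘_; id)
open import Function.Definitions using (Injective)
open import Relation.Binary.Construct.Closure.ReflexiveTransitive as Star using (Star; ε; _◅_; _◅◅_)
open import Relation.Binary.PropositionalEquality
open import Relation.Nullary using (¬_; ¬?; Dec; yes; no; does; Reflects; ofʸ; ofⁿ; _×-dec_)

-- Local bijectivity asks for preimages and is not a condition on pairs as it stands. Between finite
-- sets of equal size an injection is onto, so surjectivity is traded for equality of the degrees of
-- a vertex and its image, which fits into the binary constraint.
--
-- Pairwise consistency of tuples suffices thanks to the clause that equal vertices have equal
-- images. For a tuple paired with itself it makes a supporting partial solution coincide with the
-- supported one, which therefore obeys the constraints inside the tuple; for adjacent nodes it
-- makes the images of shared vertices agree. The agreement spreads over the tree because the nodes
-- whose enlarged bag contains v form a subtree: the subtrees of the neighbours of v all meet that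
-- of v.
--
-- Machine loops test only whether a stack is empty, which is why numbers are kept in unary; their
-- sizes are then part of the cost, and every value needs a polynomial bound alongside its program.

-- Polynomial bounds

infixl 6 _⊕_
infixl 7 _⊗_
infixr 8 _⊚_

-- Bounds are kept as syntax, with composition, because a cost is a polynomial in a size that is
-- itself polynomially bounded. The bounds of programs then match by computation, and only the final
-- one is brought into the form `c * suc x ^ e`.
data Pol : Set where
  arg       : Pol
  con       : ℕ → Pol
  _⊕_ _⊗_ _⊚_ : Pol → Pol → Pol

evalP : Pol → ℕ → ℕ
evalP arg       x = x
evalP (con n)   x = n
evalP (p ⊕ q) x = evalP p x + evalP q x
evalP (p ⊗ q) x = evalP p x * evalP q x
evalP (p ⊚ q) x = evalP p (evalP q x)

^-distribʳ-* : ∀ e a b → (a * b) ^ e ≡ a ^ e * b ^ e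
^-distribʳ-* zero    a b = refl
^-distribʳ-* (suc e) a b =
  trans (cong (a * b *_) (^-distribʳ-* e a b)) ([m*n]*[o*p]≡[m*o]*[n*p] a b (a ^ e) (b ^ e))

evalP-bounded : ∀ p → ∃[ c ] ∃[ e ] ∀ x → evalP p x ≤ c * suc x ^ e
evalP-bounded arg = 1 , 1 , λ x → begin
  x               ≤⟨ n≤1+n x ⟩
  suc x           ≡⟨ sym (trans (*-identityˡ _) (*-identityʳ _)) ⟩
  1 * (suc x ^ 1) ∎
  where open ≤-Reasoning
evalP-bounded (con n) = n , 0 , λ x → ≤-reflexive (sym (*-identityʳ n))
evalP-bounded (p ⊕ q) with evalP-bounded p | evalP-bounded q
... | c , e , h | c′ , e′ , h′ = c + c′ , e + e′ , λ x → begin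
  evalP p x + evalP q x
    ≤⟨ +-mono-≤ (h x) (h′ x) ⟩
  c * suc x ^ e + c′ * suc x ^ e′
    ≤⟨ +-mono-≤ (*-monoʳ-≤ c (^-monoʳ-≤ (suc x) (m≤m+n e e′)))
                (*-monoʳ-≤ c′ (^-monoʳ-≤ (suc x) (m≤n+m e′ e))) ⟩
  c * suc x ^ (e + e′) + c′ * suc x ^ (e + e′)
    ≡⟨ sym (*-distribʳ-+ (suc x ^ (e + e′)) c c′) ⟩
  (c + c′) * suc x ^ (e + e′) ∎
  where open ≤-Reasoning
evalP-bounded (p ⊗ q) with evalP-bounded p | evalP-bounded q
... | c , e , h | c′ , e′ , h′ = c * c′ , e + e′ , λ x → begin
  evalP p x * evalP q x
    ≤⟨ *-mono-≤ (h x) (h′ x) ⟩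
  (c * suc x ^ e) * (c′ * suc x ^ e′)
    ≡⟨ [m*n]*[o*p]≡[m*o]*[n*p] c (suc x ^ e) c′ (suc x ^ e′) ⟩
  (c * c′) * (suc x ^ e * suc x ^ e′)
    ≡⟨ cong ((c * c′) *_) (sym (^-distribˡ-+-* (suc x) e e′)) ⟩
  (c * c′) * suc x ^ (e + e′) ∎
  where open ≤-Reasoning
evalP-bounded (p ⊚ q) with evalP-bounded p | evalP-bounded q
... | c , e , h | c′ , e′ , h′ = c * suc c′ ^ e , e′ * e , λ x → begin
  evalP p (evalP q x)
    ≤⟨ h (evalP q x) ⟩
  c * suc (evalP q x) ^ e
    ≤⟨ *-monoʳ-≤ c (^-monoˡ-≤ e (s≤s (h′ x))) ⟩
  c * suc (c′ * suc x ^ e′) ^ e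
    -- Since `suc x ^ e′` is at least 1, the added 1 is absorbed into the coefficient `suc c′`.
    ≤⟨ *-monoʳ-≤ c (^-monoˡ-≤ e (+-monoˡ-≤ (c′ * suc x ^ e′) (m^n>0 (suc x) e′))) ⟩
  c * (suc c′ * suc x ^ e′) ^ e
    ≡⟨ cong (c *_) (^-distribʳ-* e (suc c′) (suc x ^ e′)) ⟩
  c * (suc c′ ^ e * (suc x ^ e′) ^ e)
    ≡⟨ cong (λ z → c * (suc c′ ^ e * z)) (^-*-assoc (suc x) e′ e) ⟩
  c * (suc c′ ^ e * suc x ^ (e′ * e))
    ≡⟨ sym (*-assoc c _ _) ⟩
  c * suc c′ ^ e * suc x ^ (e′ * e) ∎
  where open ≤-Reasoning

-- Runs with bounded cost

infix 4 _∣_⇓≤[_]_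

_∣_⇓≤[_]_ : ∀ {k} → Program k → Store k → ℕ → Store k → Set
p ∣ σ ⇓≤[ b ] τ = ∃[ n ] (n ≤ b × p ∣ σ ⇓[ n ] τ)

module _ {k : ℕ} where

  infixr 5 _then_

  run : ∀ {p : Program k} {σ n τ} → p ∣ σ ⇓[ n ] τ → p ∣ σ ⇓≤[ n ] τ
  run d = _ , ≤-refl , d

  relax : ∀ {p : Program k} {σ a b τ} → a ≤ b → p ∣ σ ⇓≤[ a ] τ → p ∣ σ ⇓≤[ b ] τ
  relax a≤b (n , n≤a , d) = n , ≤-trans n≤a a≤b , d

  into : ∀ {p : Program k} {σ b τ υ} → τ ≡ υ → p ∣ σ ⇓≤[ b ] τ → p ∣ σ ⇓≤[ b ] υ
  into refl d = d

  _then_ : ∀ {p q : Program k} {σ τ υ a b} →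
           p ∣ σ ⇓≤[ a ] τ → q ∣ τ ⇓≤[ b ] υ → (p ⨾ q) ∣ σ ⇓≤[ a + b ] υ
  (m , m≤a , d) then (n , n≤b , e) = m + n , +-mono-≤ m≤a n≤b , ⇓seq d e

  pushes : ∀ {r b} {σ : Store k} → push r b ∣ σ ⇓≤[ 1 ] (σ [ r ]%= (b ∷_))
  pushes = run ⇓push

  pops : ∀ {r} {σ : Store k} → pop r ∣ σ ⇓≤[ 1 ] (σ [ r ]%= List.drop 1)
  pops = run ⇓pop

  skips : ∀ {σ : Store k} → skip ∣ σ ⇓≤[ 1 ] σ
  skips = run ⇓skip

  caseEmpty : ∀ {r} {p q s : Program k} {σ τ b} → lookup σ r ≡ [] →
              p ∣ σ ⇓≤[ b ] τ → case r p q s ∣ σ ⇓≤[ suc b ] τ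
  caseEmpty eq (n , n≤b , d) = suc n , s≤s n≤b , ⇓caseEmpty eq d

  caseFalse : ∀ {r} {p q s : Program k} {σ τ b bs} → lookup σ r ≡ false ∷ bs →
              q ∣ σ ⇓≤[ b ] τ → case r p q s ∣ σ ⇓≤[ suc b ] τ
  caseFalse eq (n , n≤b , d) = suc n , s≤s n≤b , ⇓caseFalse eq d

  caseTrue : ∀ {r} {p q s : Program k} {σ τ b bs} → lookup σ r ≡ true ∷ bs →
             s ∣ σ ⇓≤[ b ] τ → case r p q s ∣ σ ⇓≤[ suc b ] τ
  caseTrue eq (n , n≤b , d) = suc n , s≤s n≤b , ⇓caseTrue eq d

  whileDone : ∀ {r p} {σ : Store k} → lookup σ r ≡ [] → while r p ∣ σ ⇓≤[ 1 ] σ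
  whileDone eq = run (⇓whileDone eq)

  whileStep : ∀ {r p} {σ τ υ : Store k} {a b x xs} → lookup σ r ≡ x ∷ xs →
              p ∣ σ ⇓≤[ a ] τ → while r p ∣ τ ⇓≤[ b ] υ →
              while r p ∣ σ ⇓≤[ suc (a + b) ] υ
  whileStep eq (m , m≤a , d) (n , n≤b , e) =
    suc (m + n) , s≤s (+-mono-≤ m≤a n≤b) , ⇓whileStep eq d e

  -- σ r x is the store with r rounds to go after x rounds.
  while-run : ∀ {r p β} {xs : ℕ → List Bool} {N} (σ : ℕ → ℕ → Store k) →
              (∀ {a x} → lookup (σ (suc a) x) r ≡ true ∷ xs a) →
              (∀ {x} → lookup (σ 0 x) r ≡ []) →
              (∀ a x → x + suc a ≡ N → p ∣ σ (suc a) x ⇓≤[ β ] σ a (suc x)) →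
              ∀ {s} → N ≤ s → while r p ∣ σ N 0 ⇓≤[ suc (s * suc β) ] σ 0 N
  while-run {r} {p} {β} {N = N} σ more done body N≤s =
    relax (s≤s (*-monoˡ-≤ (suc β) N≤s)) (rounds N 0 refl)
    where
    rounds : ∀ a x → x + a ≡ N → while r p ∣ σ a x ⇓≤[ suc (a * suc β) ] σ 0 N
    rounds zero x eq rewrite sym (trans (sym (+-identityʳ x)) eq) = whileDone done
    rounds (suc a) x eq =
      relax (s≤s (≤-reflexive (+-suc β (a * suc β))))
        (whileStep more (body a x eq) (rounds a (suc x) (trans (sym (+-suc x a)) eq)))

  pour : Fin k → Fin k → Program k
  pour s d = while s (case s skip (pop s ⨾ push d false) (pop s ⨾ push d true))

  -- The store enters as a family over the contents of the two stacks, with equations that hold by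
  -- `refl` at concrete registers; so one proof serves every pair of stacks.
  pour-run : ∀ {s d} (σ : List Bool → List Bool → Store k) →
             (∀ {x y} → lookup (σ x y) s ≡ x) →
             (∀ {x y} → σ x y [ s ]%= List.drop 1 ≡ σ (List.drop 1 x) y) →
             (∀ {x y b} → σ x y [ d ]%= (b ∷_) ≡ σ x (b ∷ y)) →
             ∀ xs ys {n} → length xs ≤ n → pour s d ∣ σ xs ys ⇓≤[ suc (n * 4) ] σ [] (xs ʳ++ ys)
  pour-run {s} {d} σ look drp psh xs ys xs≤n = relax (s≤s (*-monoˡ-≤ 4 xs≤n)) (go xs ys)
    where
    move : ∀ b xs ys → (pop s ⨾ push d b) ∣ σ (b ∷ xs) ys ⇓≤[ 2 ] σ xs (b ∷ ys)
    move b xs ys = into (trans (cong (_[ d ]%= (b ∷_)) drp) psh) (pops then pushes)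

    go : ∀ xs ys → pour s d ∣ σ xs ys ⇓≤[ suc (length xs * 4) ] σ [] (xs ʳ++ ys)
    go [] ys = whileDone look
    go (false ∷ xs) ys = whileStep look (caseFalse look (move false xs ys)) (go xs (false ∷ ys))
    go (true ∷ xs) ys = whileStep look (caseTrue look (move true xs ys)) (go xs (true ∷ ys))

-- Adding a register

mapP : ∀ {j k} → (Fin j → Fin k) → Program j → Program k
mapP f skip = skip
mapP f (push r b) = push (f r) b
mapP f (pop r) = pop (f r)
mapP f (p ⨾ q) = mapP f p ⨾ mapP f q
mapP f (case r p q s) = case (f r) (mapP f p) (mapP f q) (mapP f s)
mapP f (while r p) = while (f r) (mapP f p)

updateAt-punchIn : ∀ {A : Set} {n} (xs : Vec A n) (i : Fin (suc n)) (v : A) (j : Fin n) (f : A → A) →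
                   updateAt (insertAt xs i v) (punchIn i j) f ≡ insertAt (updateAt xs j f) i v
updateAt-punchIn xs       zero    v j       f = refl
updateAt-punchIn (x ∷ xs) (suc i) v zero    f = refl
updateAt-punchIn (x ∷ xs) (suc i) v (suc j) f = cong (x ∷_) (updateAt-punchIn xs i v j f)

-- A program that never names the inserted stack neither reads nor changes it, so the run is the
-- same step for step. This protects a loop counter from the body of its loop.
mapP-punchIn : ∀ {k} {p : Program k} {σ n τ} (i : Fin (suc k)) x → p ∣ σ ⇓[ n ] τ →
               mapP (punchIn i) p ∣ insertAt σ i x ⇓[ n ] insertAt τ i x
mapP-punchIn i x ⇓skip = ⇓skip
mapP-punchIn {σ = σ} i x (⇓push {r = r} {b}) =
  subst (_ ∣ _ ⇓[ _ ]_) (updateAt-punchIn σ i x r (b ∷_)) ⇓push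
mapP-punchIn {σ = σ} i x (⇓pop {r = r}) =
  subst (_ ∣ _ ⇓[ _ ]_) (updateAt-punchIn σ i x r (List.drop 1)) ⇓pop
mapP-punchIn i x (⇓seq d e) = ⇓seq (mapP-punchIn i x d) (mapP-punchIn i x e)
mapP-punchIn i x (⇓caseEmpty eq d) =
  ⇓caseEmpty (trans (insertAt-punchIn _ i x _) eq) (mapP-punchIn i x d)
mapP-punchIn i x (⇓caseFalse eq d) =
  ⇓caseFalse (trans (insertAt-punchIn _ i x _) eq) (mapP-punchIn i x d)
mapP-punchIn i x (⇓caseTrue eq d) =
  ⇓caseTrue (trans (insertAt-punchIn _ i x _) eq) (mapP-punchIn i x d)
mapP-punchIn i x (⇓whileDone eq) = ⇓whileDone (trans (insertAt-punchIn _ i x _) eq)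
mapP-punchIn i x (⇓whileStep eq d e) =
  ⇓whileStep (trans (insertAt-punchIn _ i x _) eq) (mapP-punchIn i x d) (mapP-punchIn i x e)

-- mem holds the word being rewritten, new its successor under construction
-- and num a stack of numbers in unary; the other registers are scratch.
mem aux new num put cnt tmp flag : ∀ {D} → Fin (8 + D)
mem  = 0F
aux  = 1F
new  = 2F
num  = 3F
put  = 4F
cnt  = 5F
tmp  = 6F
flag = 7F

counter : ∀ {D} → Fin (9 + D)
counter = 8F

full : (M Z U N P A B F : List Bool) → ∀ {D} → Store D → Store (8 + D)
full M Z U N P A B F cs = M ∷ Z ∷ U ∷ N ∷ P ∷ A ∷ B ∷ F ∷ cs

-- Unary numbers on stacks

ones : ℕ → List Bool → List Bool
ones zero    xs = xs
ones (suc a) xs = true ∷ ones a xs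

enc : List ℕ → List Bool
enc []       = []
enc (a ∷ zs) = ones a (false ∷ enc zs)

ones-ones : ∀ a b xs → ones a (ones b xs) ≡ ones (a + b) xs
ones-ones zero    b xs = refl
ones-ones (suc a) b xs = cong (true ∷_) (ones-ones a b xs)

spend : ∀ {k} → Fin k → Program k → Program k
spend r p = while r (pop r ⨾ p)

module _ {k : ℕ} where

  -- A loop stops only at an empty stack, whereas a number ends at its terminator with other numbers
  -- below. The single bit on `flag` is therefore the loop condition; meeting `false` removes the
  -- terminator and clears the flag.
  shift : Fin (8 + k) → Fin (8 + k) → Program (8 + k)
  shift s d = push flag true ⨾ while flag
    (case s (pop flag) (pop s ⨾ pop flag) (pop s ⨾ push d true))

  shift-run : ∀ {s d} (σ : List Bool → List Bool → List Bool → Store (8 + k)) →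
              (∀ {x y z} → lookup (σ x y z) s ≡ x) →
              (∀ {x y z} → lookup (σ x y z) flag ≡ z) →
              (∀ {x y z} → σ x y z [ s ]%= List.drop 1 ≡ σ (List.drop 1 x) y z) →
              (∀ {x y z} → σ x y z [ d ]%= (true ∷_) ≡ σ x (true ∷ y) z) →
              (∀ {x y z f} → σ x y z [ flag ]%= f ≡ σ x y (f z)) →
              ∀ a xs ys {n} → a ≤ n →
              shift s d ∣ σ (ones a (false ∷ xs)) ys [] ⇓≤[ 6 + n * 4 ] σ xs (ones a ys) []
  shift-run {s} {d} σ look lookF drp psh updF a xs ys a≤n =
    relax (+-monoʳ-≤ 6 (*-monoˡ-≤ 4 a≤n))
      (into updF pushes then into (cong (λ b → σ xs (ones b ys) []) (+-identityʳ a)) (go a 0))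
    where
    go : ∀ a x → while flag (case s (pop flag) (pop s ⨾ pop flag) (pop s ⨾ push d true))
           ∣ σ (ones a (false ∷ xs)) (ones x ys) (true ∷ []) ⇓≤[ 5 + a * 4 ] σ xs (ones (a + x) ys) []
    go zero x = whileStep lookF
      (caseFalse look (into (trans (cong (_[ flag ]%= List.drop 1) drp) updF) (pops then pops)))
      (whileDone lookF)
    go (suc a) x = whileStep lookF
      (caseTrue look (into (trans (cong (_[ d ]%= (true ∷_)) drp) psh) (pops then pushes)))
      (into (cong (λ b → σ xs (ones b ys) []) (+-suc a x)) (go a (suc x)))

  -- On `cnt` a number has no terminator, so it can drive a loop; on `put` it keeps one, so that
  -- several numbers can be piled up.
  unload load save restore : Program (8 + k)
  unload  = shift num cnt
  load    = push num false ⨾ spend cnt (push num true)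
  save    = push put false ⨾ shift num put
  restore = push num false ⨾ shift put num

  module _ {M Z U : List Bool} {cs : Store k} where

    unload-run : ∀ {a N P B s} → a ≤ s →
      unload ∣ full M Z U (ones a (false ∷ N)) P [] B [] cs
        ⇓≤[ 6 + s * 4 ] full M Z U N P (ones a []) B [] cs
    unload-run {a} {N} {P} {B} = shift-run (λ x y z → full M Z U x P y B z cs)
      refl refl refl refl refl a N []

    load-run : ∀ {a N P B s} → a ≤ s →
      load ∣ full M Z U N P (ones a []) B [] cs
        ⇓≤[ 1 + suc (s * 3) ] full M Z U (ones a (false ∷ N)) P [] B [] cs
    load-run {a} {N} {P} {B} a≤s = pushes then while-run
      (λ r x → full M Z U (ones x (false ∷ N)) P (ones r []) B [] cs)
      refl refl (λ r x _ → pops then pushes) a≤s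

    save-run : ∀ {a N P A B s} → a ≤ s →
      save ∣ full M Z U (ones a (false ∷ N)) P A B [] cs
        ⇓≤[ 1 + (6 + s * 4) ] full M Z U N (ones a (false ∷ P)) A B [] cs
    save-run {a} {N} {P} {A} {B} a≤s = pushes then
      shift-run (λ x y z → full M Z U x y A B z cs) refl refl refl refl refl a N (false ∷ P) a≤s

    restore-run : ∀ {a N P A B s} → a ≤ s →
      restore ∣ full M Z U N (ones a (false ∷ P)) A B [] cs
        ⇓≤[ 1 + (6 + s * 4) ] full M Z U (ones a (false ∷ N)) P A B [] cs
    restore-run {a} {N} {P} {A} {B} a≤s = pushes then
      shift-run (λ x y z → full M Z U y x A B z cs) refl refl refl refl refl a P (false ∷ N) a≤s

size : List ℕ → ℕ
size []       = 0
size (a ∷ zs) = suc a + size zs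

data At : List ℕ → ℕ → ℕ → Set where
  here  : ∀ {a zs} → At (a ∷ zs) 0 a
  there : ∀ {a b zs p} → At zs p a → At (b ∷ zs) (suc p) a

At-size : ∀ {zs p a} → At zs p a → a ≤ size zs
At-size (here {a} {zs})  = m≤n⇒m≤1+n (m≤m+n a (size zs))
At-size (there {b = b} {zs} at) = ≤-trans (At-size at) (m≤n+m (size zs) (suc b))

top≤ : ∀ {a zs s} → size (a ∷ zs) ≤ s → a ≤ s
top≤ {a} {zs} h = ≤-trans (m≤n⇒m≤1+n (m≤m+n a (size zs))) h

rest≤ : ∀ {a zs s} → size (a ∷ zs) ≤ s → size zs ≤ s
rest≤ {a} {zs} h = ≤-trans (m≤n+m (size zs) (suc a)) h

-- Reading past the end yields true: a table that has not been written yet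
-- counts as full.
get : List Bool → ℕ → Bool
get []       _       = true
get (x ∷ xs) zero    = x
get (x ∷ xs) (suc a) = get xs a

b2n : Bool → ℕ
b2n false = 0
b2n true  = 1

-- A cursor in a word: the unread part and, reversed, the part already read. At the end of the word
-- it stays put, so walking too far is harmless.
advance : List Bool × List Bool → List Bool × List Bool
advance ([]     , ys) = [] , ys
advance (x ∷ xs , ys) = xs , x ∷ ys

walk : List Bool → ℕ → List Bool × List Bool
walk xs zero    = xs , []
walk xs (suc a) = advance (walk xs a)

advance-get : ∀ st a → get (proj₁ (advance st)) a ≡ get (proj₁ st) (suc a)
advance-get ([]     , ys) a = refl
advance-get (x ∷ xs , ys) a = refl

walk-get : ∀ xs a b → get (proj₁ (walk xs a)) b ≡ get xs (a + b)
walk-get xs zero    b = refl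
walk-get xs (suc a) b = trans (advance-get (walk xs a) b)
  (trans (walk-get xs a (suc b)) (cong (get xs) (+-suc a b)))

advance-ʳ++ : ∀ st → proj₂ (advance st) ʳ++ proj₁ (advance st) ≡ proj₂ st ʳ++ proj₁ st
advance-ʳ++ ([]     , ys) = refl
advance-ʳ++ (x ∷ xs , ys) = refl

-- The reason why `fetch` leaves the memory intact: pouring `aux` back onto `mem` undoes any number
-- of cursor moves.
walk-ʳ++ : ∀ xs a → proj₂ (walk xs a) ʳ++ proj₁ (walk xs a) ≡ xs
walk-ʳ++ xs zero    = refl
walk-ʳ++ xs (suc a) = trans (advance-ʳ++ (walk xs a)) (walk-ʳ++ xs a)

walk-length : ∀ xs a → length (proj₂ (walk xs a)) ≤ length xs
walk-length xs a = begin
  length (proj₂ (walk xs a))                               ≤⟨ m≤m+n _ _ ⟩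
  length (proj₂ (walk xs a)) + length (proj₁ (walk xs a))  ≡⟨ sym (length-ʳ++ (proj₂ (walk xs a))) ⟩
  length (proj₂ (walk xs a) ʳ++ proj₁ (walk xs a))         ≡⟨ cong length (walk-ʳ++ xs a) ⟩
  length xs                                                ∎
  where open ≤-Reasoning

unloadP : Pol
unloadP = con 6 ⊕ arg ⊗ con 4

spendP : Pol → Pol
spendP β = con 1 ⊕ arg ⊗ (con 1 ⊕ β)

-- Arithmetic on the number stack

module _ {k : ℕ} where

  -- Reading a unary number destroys it, so it is rebuilt on `num` while its copy grows on `tmp`.
  -- The numbers above it wait on `put`.
  peek : ℕ → Program (8 + k)
  peek zero    = unload ⨾ push num false ⨾ spend cnt (push num true ⨾ push tmp true)
  peek (suc p) = save ⨾ peek p ⨾ restore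

  pick : ℕ → Program (8 + k)
  pick p = peek p ⨾ push num false ⨾ spend tmp (push num true)

  literal : ℕ → Program (8 + k)
  literal zero    = push num false
  literal (suc n) = literal n ⨾ push num true

  add monus mul fetch nip discard : Program (8 + k)
  add     = unload ⨾ spend cnt (push num true)
  -- A top bit `false` is the terminator of the minuend, which has then reached 0 and must stay
  -- there.
  monus   = unload ⨾ spend cnt (case num skip skip (pop num))
  mul     = unload ⨾ spend cnt (push tmp true) ⨾ unload ⨾ push num false ⨾
            -- Each round empties `tmp` onto the product and refills it from the copy on `put`, so
            -- that the factor is there again for the next round.
            spend cnt (spend tmp (push put true ⨾ push num true) ⨾ spend put (push tmp true)) ⨾
            spend tmp skip
  fetch   = unload ⨾
            spend cnt (case mem skip (pop mem ⨾ push aux false) (pop mem ⨾ push aux true)) ⨾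
            push num false ⨾
            -- `num` has just received a 0; it becomes 1 also when the word is exhausted, in
            -- accordance with `get`.
            case mem (push num true) skip (push num true) ⨾
            pour aux mem
  nip     = unload ⨾ spend cnt (push tmp true) ⨾ unload ⨾ spend cnt skip ⨾
            push num false ⨾ spend tmp (push num true)
  discard = unload ⨾ spend cnt skip

peekP pickP literalP : ℕ → Pol
peekP zero    = unloadP ⊕ (con 1 ⊕ spendP (con 3))
peekP (suc p) = (con 1 ⊕ unloadP) ⊕ (peekP p ⊕ (con 1 ⊕ unloadP))
pickP p = peekP p ⊕ (con 1 ⊕ spendP (con 2))
literalP zero    = con 1
literalP (suc n) = literalP n ⊕ con 1

addP monusP mulP fetchP nipP discardP : Pol
addP     = unloadP ⊕ spendP (con 2)
monusP   = unloadP ⊕ spendP (con 3)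
mulP     = unloadP ⊕ (spendP (con 2) ⊕ (unloadP ⊕ (con 1 ⊕
           (spendP (con 1 ⊕ (spendP (con 3) ⊕ spendP (con 2))) ⊕ spendP (con 2)))))
fetchP   = unloadP ⊕ (spendP (con 4) ⊕ (con 1 ⊕ (con 2 ⊕ (con 1 ⊕ arg ⊗ con 4))))
nipP     = unloadP ⊕ (spendP (con 2) ⊕ (unloadP ⊕ (spendP (con 2) ⊕ (con 1 ⊕ spendP (con 2)))))
discardP = unloadP ⊕ spendP (con 2)

module _ {k : ℕ} {M U : List Bool} {cs : Store k} {s : ℕ} where

  rest : List ℕ → Store (8 + k)
  rest zs = full M [] U (enc zs) [] [] [] [] cs

  peek-run : ∀ {zs p a} P → At zs p a → size zs ≤ s →
    peek p ∣ full M [] U (enc zs) P [] [] [] cs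
      ⇓≤[ evalP (peekP p) s ] full M [] U (enc zs) P [] (ones a []) [] cs
  peek-run {a ∷ zs} P here h = unload-run (top≤ {a} {zs} h) then pushes then while-run
    (λ r x → full M [] U (ones x (false ∷ enc zs)) P (ones r []) (ones x []) [] cs)
    refl refl (λ r x _ → pops then pushes then pushes) (top≤ {a} {zs} h)
  peek-run {b ∷ zs} P (there at) h =
    save-run (top≤ {b} {zs} h) then peek-run (ones b (false ∷ P)) at (rest≤ {b} {zs} h)
    then restore-run (top≤ {b} {zs} h)

  pick-run : ∀ {zs p a} → At zs p a → size zs ≤ s →
    pick p ∣ rest zs ⇓≤[ evalP (pickP p) s ] rest (a ∷ zs)
  pick-run {zs} at h = peek-run [] at h then pushes then while-run
    (λ r x → full M [] U (ones x (false ∷ enc zs)) [] [] (ones r []) [] cs)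
    refl refl (λ r x _ → pops then pushes) (≤-trans (At-size at) h)

  literal-run : ∀ n {zs} → literal n ∣ rest zs ⇓≤[ evalP (literalP n) s ] rest (n ∷ zs)
  literal-run zero    = pushes
  literal-run (suc n) {zs} = literal-run n {zs} then pushes

  add-run : ∀ {a b zs} → a ≤ s → add ∣ rest (a ∷ b ∷ zs) ⇓≤[ evalP addP s ] rest (a + b ∷ zs)
  add-run {a} {b} {zs} a≤s = unload-run a≤s then
    into (cong (λ x → full M [] U x [] [] [] [] cs) (ones-ones a b (false ∷ enc zs)))
    (while-run (λ r x → full M [] U (ones x (ones b (false ∷ enc zs))) [] (ones r []) [] [] cs)
      refl refl (λ r x _ → pops then pushes) a≤s)

  monus-run : ∀ {a b zs} → a ≤ s → monus ∣ rest (a ∷ b ∷ zs) ⇓≤[ evalP monusP s ] rest (b ∸ a ∷ zs)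
  monus-run {a} {b} {zs} a≤s = unload-run a≤s then
    while-run (λ r x → full M [] U (ones (b ∸ x) (false ∷ enc zs)) [] (ones r []) [] [] cs)
      refl refl (λ r x _ → step r x) a≤s
    where
    step : ∀ r x → (pop cnt ⨾ case num skip skip (pop num)) ∣
      full M [] U (ones (b ∸ x) (false ∷ enc zs)) [] (ones (suc r) []) [] [] cs ⇓≤[ 3 ]
      full M [] U (ones (b ∸ suc x) (false ∷ enc zs)) [] (ones r []) [] [] cs
    step r x rewrite sym (pred[m∸n]≡m∸[1+n] b x) with b ∸ x
    ... | zero  = pops then caseFalse refl skips
    ... | suc _ = pops then caseTrue refl pops

  mul-run : ∀ {a b zs} → a ≤ s → b ≤ s → mul ∣ rest (b ∷ a ∷ zs) ⇓≤[ evalP mulP s ] rest (a * b ∷ zs)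
  mul-run {a} {b} {zs} a≤s b≤s = unload-run b≤s
    then while-run (λ r x → full M [] U (enc (a ∷ zs)) [] (ones r []) (ones x []) [] cs)
      refl refl (λ r x _ → pops then pushes) b≤s
    then unload-run a≤s
    then pushes
    then while-run (λ r x → full M [] U (ones (x * b) (false ∷ enc zs)) [] (ones r []) (ones b []) [] cs)
      refl refl
      (λ r x _ → pops
        then into (cong (λ y → full M [] U y (ones b []) (ones r []) [] [] cs) (ones-ones b (x * b) (false ∷ enc zs)))
          (while-run (λ r′ y → full M [] U (ones y (ones (x * b) (false ∷ enc zs))) (ones y []) (ones r []) (ones r′ []) [] cs)
            refl refl (λ _ _ _ → pops then pushes then pushes) b≤s)
        then while-run (λ r′ y → full M [] U (ones (suc x * b) (false ∷ enc zs)) (ones r′ []) (ones r []) (ones y []) [] cs)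
          refl refl (λ _ _ _ → pops then pushes) b≤s)
      a≤s
    then while-run (λ r x → full M [] U (ones (a * b) (false ∷ enc zs)) [] [] (ones r []) [] cs)
      refl refl (λ _ _ _ → pops then skips) b≤s

  nip-run : ∀ {a b zs} → a ≤ s → b ≤ s → nip ∣ rest (a ∷ b ∷ zs) ⇓≤[ evalP nipP s ] rest (a ∷ zs)
  nip-run {a} {b} {zs} a≤s b≤s = unload-run a≤s
    then while-run (λ r x → full M [] U (enc (b ∷ zs)) [] (ones r []) (ones x []) [] cs)
      refl refl (λ _ _ _ → pops then pushes) a≤s
    then unload-run b≤s
    then while-run (λ r x → full M [] U (enc zs) [] (ones r []) (ones a []) [] cs)
      refl refl (λ _ _ _ → pops then skips) b≤s
    then pushes
    then while-run (λ r x → full M [] U (ones x (false ∷ enc zs)) [] [] (ones r []) [] cs)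
      refl refl (λ _ _ _ → pops then pushes) a≤s

  discard-run : ∀ {a zs} → a ≤ s → discard ∣ rest (a ∷ zs) ⇓≤[ evalP discardP s ] rest zs
  discard-run {a} {zs} a≤s = unload-run a≤s
    then while-run (λ r x → full M [] U (enc zs) [] (ones r []) [] [] cs)
      refl refl (λ _ _ _ → pops then skips) a≤s

  fetch-run : ∀ {a zs} → a ≤ s → length M ≤ s →
    fetch ∣ rest (a ∷ zs) ⇓≤[ evalP fetchP s ] rest (b2n (get M a) ∷ zs)
  fetch-run {a} {zs} a≤s M≤s = unload-run a≤s
    then while-run (λ r x → full (proj₁ (walk M x)) (proj₂ (walk M x)) U (enc zs) [] (ones r []) [] [] cs)
      refl refl (λ r x _ → pops then step r (walk M x)) a≤s
    then pushes
    then into (cong (λ b → at (enc (b2n b ∷ zs))) (trans (walk-get M a 0) (cong (get M) (+-identityʳ a))))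
      (read (proj₁ (walk M a)) _)
    then into (cong (λ x → full x [] U (enc (b2n (get M a) ∷ zs)) [] [] [] [] cs) (walk-ʳ++ M a))
      (pour-run (λ x y → full y x U (enc (b2n (get M a) ∷ zs)) [] [] [] [] cs) refl refl refl
        (proj₂ (walk M a)) (proj₁ (walk M a)) (≤-trans (walk-length M a) M≤s))
    where
    at : List Bool → Store (8 + k)
    at N = full (proj₁ (walk M a)) (proj₂ (walk M a)) U N [] [] [] [] cs

    step : ∀ r st → case mem skip (pop mem ⨾ push aux false) (pop mem ⨾ push aux true) ∣
      full (proj₁ st) (proj₂ st) U (enc zs) [] (ones r []) [] [] cs ⇓≤[ 3 ]
      full (proj₁ (advance st)) (proj₂ (advance st)) U (enc zs) [] (ones r []) [] [] cs
    step r ([]         , _) = relax (s≤s (s≤s z≤n)) (caseEmpty refl skips)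
    step r (false ∷ _ , _) = caseFalse refl (pops then pushes)
    step r (true  ∷ _ , _) = caseTrue refl (pops then pushes)

    read : ∀ xs ys → case mem (push num true) skip (push num true) ∣
      full xs ys U (enc (0 ∷ zs)) [] [] [] [] cs ⇓≤[ 2 ]
      full xs ys U (enc (b2n (get xs 0) ∷ zs)) [] [] [] [] cs
    read []          ys = caseEmpty refl pushes
    read (false ∷ _) ys = caseFalse refl skips
    read (true ∷ _)  ys = caseTrue refl pushes

-- Arithmetic expressions and their compilation

-- Finitely many names, so that a value for each can lie on the number stack from the start, as in
-- `zs₀`; then `Sees` can be demanded of all names at once.
Name : Set
Name = Fin 20

Env : Set
Env = Name → ℕ

infix 9 _[_≔_]

_[_≔_] : Env → Name → ℕ → Env
(γ [ x ≔ v ]) y = if does (x Fin.≟ y) then v else γ y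

infixl 6 _+ᵉ_ _∸ᵉ_
infixl 7 _*ᵉ_

data Exp : Set where
  var            : Name → Exp
  lit            : ℕ → Exp
  _+ᵉ_ _∸ᵉ_ _*ᵉ_ : Exp → Exp → Exp
  bit            : Exp → Exp
  sumᵉ letᵉ      : Name → Exp → Exp → Exp

-- The last term is split off because the compiled loop counts upwards: after `v` rounds the
-- accumulator holds `Σ< v f`, and the next round adds `f v`.
Σ< : ℕ → (ℕ → ℕ) → ℕ
Σ< zero    f = 0
Σ< (suc n) f = f n + Σ< n f

⟦_⟧ : Exp → List Bool → Env → ℕ
⟦ var x ⟧      M γ = γ x
⟦ lit n ⟧      M γ = n
⟦ a +ᵉ b ⟧     M γ = ⟦ a ⟧ M γ + ⟦ b ⟧ M γ
⟦ a ∸ᵉ b ⟧     M γ = ⟦ a ⟧ M γ ∸ ⟦ b ⟧ M γ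
⟦ a *ᵉ b ⟧     M γ = ⟦ a ⟧ M γ * ⟦ b ⟧ M γ
⟦ bit a ⟧      M γ = b2n (get M (⟦ a ⟧ M γ))
⟦ sumᵉ x a b ⟧ M γ = Σ< (⟦ a ⟧ M γ) (λ v → ⟦ b ⟧ M (γ [ x ≔ v ]))
⟦ letᵉ x a b ⟧ M γ = ⟦ b ⟧ M (γ [ x ≔ ⟦ a ⟧ M γ ])

-- Each nested loop needs a counter register of its own.
depth : Exp → ℕ
depth (var x)      = 0
depth (lit n)      = 0
depth (a +ᵉ b)     = depth a ⊔ depth b
depth (a ∸ᵉ b)     = depth a ⊔ depth b
depth (a *ᵉ b)     = depth a ⊔ depth b
depth (bit a)      = depth a
depth (sumᵉ x a b) = suc (depth a ⊔ depth b)
depth (letᵉ x a b) = depth a ⊔ depth b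

lift : ∀ {D} → Program (8 + D) → Program (9 + D)
lift = mapP (punchIn 8F)

-- An environment ρ of stack positions tells where each variable lives; at
-- insufficient depth D the code of a loop is junk.
comp : Exp → (D : ℕ) → Env → Program (8 + D)
comp (var x)      D       ρ = pick (ρ x)
comp (lit n)      D       ρ = literal n
comp (a +ᵉ b)     D       ρ = comp b D ρ ⨾ comp a D (suc ∘ ρ) ⨾ add
comp (a ∸ᵉ b)     D       ρ = comp a D ρ ⨾ comp b D (suc ∘ ρ) ⨾ monus
comp (a *ᵉ b)     D       ρ = comp a D ρ ⨾ comp b D (suc ∘ ρ) ⨾ mul
comp (bit a)      D       ρ = comp a D ρ ⨾ fetch
comp (sumᵉ x a b) zero    ρ = skip
comp (sumᵉ x a b) (suc D) ρ =
  lift (comp a D ρ) ⨾ unload ⨾ spend cnt (push counter true) ⨾ literal 0 ⨾ literal 0 ⨾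
  -- The partial sum lies on top of the index, hence position 1 for `x`. To increment the index, the
  -- sum is taken off and put back.
  spend counter (lift (comp b D ((λ y → 2 + ρ y) [ x ≔ 1 ])) ⨾ add ⨾ unload ⨾ push num true ⨾ load) ⨾
  nip
comp (letᵉ x a b) D       ρ = comp a D ρ ⨾ comp b D ((suc ∘ ρ) [ x ≔ 0 ]) ⨾ nip

-- A bound on the value in terms of a bound on all variables. Under a binder the new variable is at
-- most the value of `a`, so the sum of both bounds serves for the enlarged environment.
valP : Exp → Pol
valP (var x)      = arg
valP (lit n)      = con n
valP (a +ᵉ b)     = valP a ⊕ valP b
valP (a ∸ᵉ b)     = valP a
valP (a *ᵉ b)     = valP a ⊗ valP b
valP (bit a)      = con 1
valP (sumᵉ x a b) = valP a ⊗ (valP b ⊚ (arg ⊕ valP a))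
valP (letᵉ x a b) = valP b ⊚ (arg ⊕ valP a)

-- The second operand runs with the first result on the stack, whose size has grown by at most
-- `1 + Va`, the 1 being the terminator.
binaryP : (Ca Va Cb Vb op : Pol) → Pol
binaryP Ca Va Cb Vb op =
  Ca ⊕ (Cb ⊚ (arg ⊕ (con 1 ⊕ Va)) ⊕ op ⊚ (arg ⊕ (con 1 ⊕ Va) ⊕ Vb))

-- `VB` bounds one summand, and `S` the stack during the loop: two terminators, an index of at most
-- `Va` and a partial sum of at most `Va` times `VB`.
module SumCost (Ca Va Cb Vb : Pol) where
  VB S S₂ body total : Pol
  VB = Vb ⊚ (arg ⊕ Va)
  S  = arg ⊕ (con 2 ⊕ (Va ⊕ Va ⊗ VB))
  S₂ = S ⊕ VB
  body = con 1 ⊕ (Cb ⊚ S ⊕ (addP ⊚ S₂ ⊕ (unloadP ⊚ S ⊕ (con 1 ⊕ (con 1 ⊕ spendP (con 2)) ⊚ S))))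
  total = Ca ⊕ (unloadP ⊚ S ⊕ (spendP (con 2) ⊚ S ⊕ (con 1 ⊕ (con 1 ⊕
          ((con 1 ⊕ Va ⊗ (con 1 ⊕ body)) ⊕ nipP ⊚ S)))))

costP : Exp → Env → Pol
costP (var x)      ρ = pickP (ρ x)
costP (lit n)      ρ = literalP n
costP (a +ᵉ b)     ρ = binaryP (costP b ρ) (valP b) (costP a (suc ∘ ρ)) (valP a) addP
costP (a ∸ᵉ b)     ρ = binaryP (costP a ρ) (valP a) (costP b (suc ∘ ρ)) (valP b) monusP
costP (a *ᵉ b)     ρ = binaryP (costP a ρ) (valP a) (costP b (suc ∘ ρ)) (valP b) mulP
costP (bit a)      ρ = costP a ρ ⊕ fetchP ⊚ (arg ⊕ valP a)
costP (sumᵉ x a b) ρ =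
  SumCost.total (costP a ρ) (valP a) (costP b ((λ y → 2 + ρ y) [ x ≔ 1 ])) (valP b)
costP (letᵉ x a b) ρ =
  binaryP (costP a ρ) (valP a) (costP b ((suc ∘ ρ) [ x ≔ 0 ])) (valP b ⊚ (arg ⊕ valP a)) nipP

Σ<-≤ : ∀ n {f c} → (∀ x → x < n → f x ≤ c) → Σ< n f ≤ n * c
Σ<-≤ zero    h = z≤n
Σ<-≤ (suc n) h = +-mono-≤ (h n ≤-refl) (Σ<-≤ n (λ x x<n → h x (m≤n⇒m≤1+n x<n)))

≔-≤ : ∀ {γ} x {v b} → (∀ y → γ y ≤ b) → v ≤ b → ∀ y → (γ [ x ≔ v ]) y ≤ b
≔-≤ x h v≤b y with x Fin.≟ y
... | yes _ = v≤b
... | no  _ = h y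

b2n≤1 : ∀ b → b2n b ≤ 1
b2n≤1 false = z≤n
b2n≤1 true  = ≤-refl

value-≤ : ∀ e {M γ s} → (∀ y → γ y ≤ s) → ⟦ e ⟧ M γ ≤ evalP (valP e) s
value-≤ (var x)      h = h x
value-≤ (lit n)      h = ≤-refl
value-≤ (a +ᵉ b)     h = +-mono-≤ (value-≤ a h) (value-≤ b h)
value-≤ (a ∸ᵉ b) {M} {γ} h = ≤-trans (m∸n≤m _ (⟦ b ⟧ M γ)) (value-≤ a h)
value-≤ (a *ᵉ b)     h = *-mono-≤ (value-≤ a h) (value-≤ b h)
value-≤ (bit a)      h = b2n≤1 _
value-≤ (sumᵉ x a b) {s = s} h = ≤-trans
  (Σ<-≤ _ (λ v v<n → value-≤ b (≔-≤ x (λ y → m≤n⇒m≤n+o _ (h y))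
    (≤-trans (<⇒≤ v<n) (m≤n⇒m≤o+n s (value-≤ a h))))))
  (*-monoˡ-≤ _ (value-≤ a h))
value-≤ (letᵉ x a b) {s = s} h =
  value-≤ b (≔-≤ x (λ y → m≤n⇒m≤n+o _ (h y)) (m≤n⇒m≤o+n s (value-≤ a h)))

Sees : Env → Env → List ℕ → Set
Sees ρ γ zs = ∀ y → At zs (ρ y) (γ y)

Sees-under : ∀ {ρ γ zs a} → Sees ρ γ zs → Sees (suc ∘ ρ) γ (a ∷ zs)
Sees-under see y = there (see y)

Sees-≔ : ∀ {ρ γ zs} x {p v} → Sees ρ γ zs → At zs p v → Sees (ρ [ x ≔ p ]) (γ [ x ≔ v ]) zs
Sees-≔ x see at y with x Fin.≟ y
... | yes _ = at
... | no  _ = see y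

lift-run : ∀ {D} {p : Program (8 + D)} {σ b τ} xs → p ∣ σ ⇓≤[ b ] τ →
           lift p ∣ insertAt σ 8F xs ⇓≤[ b ] insertAt τ 8F xs
lift-run xs (n , n≤b , d) = n , n≤b , mapP-punchIn 8F xs d

empties : ∀ D → Store D
empties D = replicate D []

module _ {M U : List Bool} where

  -- The single number `s` bounds the memory and the stack, and through `Sees` also every variable.
  -- All scratch and counter registers are empty before and after, so that codes can be chained.
  comp-run : ∀ e D {ρ γ zs s} → depth e ≤ D → Sees ρ γ zs → size zs ≤ s → length M ≤ s →
    comp e D ρ ∣ full M [] U (enc zs) [] [] [] [] (empties D)
      ⇓≤[ evalP (costP e ρ) s ] full M [] U (enc (⟦ e ⟧ M γ ∷ zs)) [] [] [] [] (empties D)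

  -- The environments of the operands may differ, which covers `letᵉ`: its operation `nip` keeps the
  -- second result and drops the bound value.
  binary-run : ∀ a b {D} {op : Program (8 + D)} {opP zs γ γ′ ρ ρ′ s v} {f : ℕ → ℕ → ℕ} →
    depth a ≤ D → depth b ≤ D → size zs ≤ s → length M ≤ s →
    Sees ρ γ zs → Sees ρ′ γ′ (⟦ a ⟧ M γ ∷ zs) → ⟦ b ⟧ M γ′ ≤ evalP v s →
    (∀ {x y t} → x ≤ t → y ≤ t →
       op ∣ full M [] U (enc (x ∷ y ∷ zs)) [] [] [] [] (empties D)
         ⇓≤[ evalP opP t ] full M [] U (enc (f y x ∷ zs)) [] [] [] [] (empties D)) →
    (comp a D ρ ⨾ comp b D ρ′ ⨾ op) ∣ full M [] U (enc zs) [] [] [] [] (empties D)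
      ⇓≤[ evalP (binaryP (costP a ρ) (valP a) (costP b ρ′) v opP) s ]
        full M [] U (enc (f (⟦ a ⟧ M γ) (⟦ b ⟧ M γ′) ∷ zs)) [] [] [] [] (empties D)
  binary-run a b {zs = zs} {γ} {s = s} {v} a≤D b≤D zs≤s M≤s see see′ b≤v op-run =
    comp-run a _ a≤D see zs≤s M≤s then
    comp-run b _ b≤D see′ az≤ (≤-trans M≤s (m≤m+n s _)) then
    op-run (m≤n⇒m≤o+n _ b≤v)
           (≤-trans (top≤ {⟦ a ⟧ M γ} {zs} az≤) (m≤m+n _ (evalP v s)))
    where
    a≤s : ⟦ a ⟧ M γ ≤ evalP (valP a) s
    a≤s = value-≤ a (λ y → ≤-trans (At-size (see y)) zs≤s)
    az≤ : size (⟦ a ⟧ M γ ∷ zs) ≤ s + (1 + evalP (valP a) s)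
    az≤ = ≤-trans (+-mono-≤ (s≤s a≤s) zs≤s) (≤-reflexive (+-comm (1 + evalP (valP a) s) s))

  comp-run (var x) D h see zs≤s M≤s = pick-run (see x) zs≤s
  comp-run (lit n) D {zs = zs} {s} h see zs≤s M≤s = literal-run {s = s} n {zs}
  comp-run (a +ᵉ b) D {γ = γ} {zs} {s} h see zs≤s M≤s =
    binary-run b a {op = add} {opP = addP} {γ′ = γ} {v = valP a} {f = λ y x → x + y}
      (m⊔n≤o⇒n≤o (depth a) _ h) (m⊔n≤o⇒m≤o (depth a) _ h) zs≤s M≤s see (Sees-under see)
      (value-≤ a (λ y → ≤-trans (At-size (see y)) zs≤s))
      (λ x≤t y≤t → add-run {zs = zs} x≤t)
  comp-run (a ∸ᵉ b) D {γ = γ} {zs} {s} h see zs≤s M≤s =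
    binary-run a b {op = monus} {opP = monusP} {γ′ = γ} {v = valP b} {f = _∸_}
      (m⊔n≤o⇒m≤o (depth a) _ h) (m⊔n≤o⇒n≤o (depth a) _ h) zs≤s M≤s see (Sees-under see)
      (value-≤ b (λ y → ≤-trans (At-size (see y)) zs≤s))
      (λ x≤t y≤t → monus-run {zs = zs} x≤t)
  comp-run (a *ᵉ b) D {γ = γ} {zs} {s} h see zs≤s M≤s =
    binary-run a b {op = mul} {opP = mulP} {γ′ = γ} {v = valP b} {f = _*_}
      (m⊔n≤o⇒m≤o (depth a) _ h) (m⊔n≤o⇒n≤o (depth a) _ h) zs≤s M≤s see (Sees-under see)
      (value-≤ b (λ y → ≤-trans (At-size (see y)) zs≤s))
      (λ x≤t y≤t → mul-run {zs = zs} y≤t x≤t)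
  comp-run (bit a) D {zs = zs} {s} h see zs≤s M≤s =
    comp-run a D h see zs≤s M≤s then
    fetch-run {zs = zs} (m≤n⇒m≤o+n s (value-≤ a (λ y → ≤-trans (At-size (see y)) zs≤s)))
      (≤-trans M≤s (m≤m+n s _))
  comp-run (letᵉ x a b) D {γ = γ} {zs} {s} h see zs≤s M≤s =
    binary-run a b {op = nip} {opP = nipP} {γ′ = γ [ x ≔ ⟦ a ⟧ M γ ]} {v = valP b ⊚ (arg ⊕ valP a)} {f = λ y x → x}
      (m⊔n≤o⇒m≤o (depth a) _ h) (m⊔n≤o⇒n≤o (depth a) _ h) zs≤s M≤s see
      (Sees-≔ x (Sees-under see) here)
      (value-≤ (letᵉ x a b) (λ y → ≤-trans (At-size (see y)) zs≤s))
      (λ x≤t y≤t → nip-run {zs = zs} x≤t y≤t)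
  comp-run (sumᵉ x a b) (suc D) {ρ} {γ} {zs} {s} (s≤s h) see zs≤s M≤s =
    lift-run [] (comp-run a D (m⊔n≤o⇒m≤o (depth a) _ h) see zs≤s M≤s)
    then unload-run n≤t
    then while-run (λ r v → full M [] U (enc zs) [] (ones r []) [] [] (ones v [] ∷ empties D))
      refl refl (λ _ _ _ → pops then pushes) n≤t
    then literal-run {s = s} 0 {zs}
    then literal-run {s = s} 0 {0 ∷ zs}
    then while-run (λ r v → full M [] U (enc (Σ< v f ∷ v ∷ zs)) [] [] [] [] (ones r [] ∷ empties D))
      refl refl
      (λ r v eq → pops
        then lift-run (ones r []) (comp-run b D {γ = γ [ x ≔ v ]} {Σ< v f ∷ v ∷ zs} (m⊔n≤o⇒n≤o (depth a) _ h)
          (Sees-≔ x (λ y → there (there (see y))) (there here)) (zs′≤ v (v≤n r v eq)) (≤-trans M≤s (m≤m+n s _)))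
        then add-run {zs = v ∷ zs} (m≤n⇒m≤o+n t (f≤ v (v≤n r v eq)))
        then unload-run (Σ≤t (suc v) (v<n r v eq))
        then pushes
        then load-run (Σ≤t (suc v) (v<n r v eq)))
      n≤V
    then nip-run {zs = zs} (Σ≤t n ≤-refl) n≤t
    where
    open SumCost (costP a ρ) (valP a) (costP b ((λ y → 2 + ρ y) [ x ≔ 1 ])) (valP b)
    γ≤s : ∀ y → γ y ≤ s
    γ≤s y = ≤-trans (At-size (see y)) zs≤s
    n = ⟦ a ⟧ M γ
    f : ℕ → ℕ
    f v = ⟦ b ⟧ M (γ [ x ≔ v ])
    V = evalP (valP a) s
    W = evalP VB s
    t = evalP S s
    n≤V : n ≤ V
    n≤V = value-≤ a γ≤s
    v<n : ∀ r v → v + suc r ≡ n → v < n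
    v<n r v eq = subst (v <_) eq (m<m+n v (s≤s z≤n))
    v≤n : ∀ r v → v + suc r ≡ n → v ≤ n
    v≤n r v eq = <⇒≤ (v<n r v eq)
    f≤ : ∀ v → v ≤ n → f v ≤ W
    f≤ v v≤ = value-≤ b (≔-≤ x (λ y → m≤n⇒m≤n+o _ (γ≤s y)) (m≤n⇒m≤o+n s (≤-trans v≤ n≤V)))
    Σ≤ : ∀ v → v ≤ n → Σ< v f ≤ V * W
    Σ≤ v v≤ = ≤-trans (Σ<-≤ v (λ u u<v → f≤ u (≤-trans (<⇒≤ u<v) v≤))) (*-monoˡ-≤ W (≤-trans v≤ n≤V))
    Σ≤t : ∀ v → v ≤ n → Σ< v f ≤ t
    Σ≤t v v≤ = ≤-trans (Σ≤ v v≤) (≤-trans (m≤n+m _ V) (≤-trans (m≤n+m _ 2) (m≤n+m _ s)))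
    n≤t : n ≤ t
    n≤t = ≤-trans n≤V (≤-trans (m≤m+n V _) (≤-trans (m≤n+m _ 2) (m≤n+m _ s)))
    zs′≤ : ∀ v → v ≤ n → size (Σ< v f ∷ v ∷ zs) ≤ t
    zs′≤ v v≤ = begin
      suc (Σ< v f) + (suc v + size zs)  ≤⟨ +-mono-≤ (s≤s (Σ≤ v v≤)) (+-mono-≤ (s≤s (≤-trans v≤ n≤V)) zs≤s) ⟩
      suc (V * W) + (suc V + s)         ≡⟨ sym (+-assoc (suc (V * W)) (suc V) s) ⟩
      suc (V * W) + suc V + s           ≡⟨ +-comm _ s ⟩
      s + (suc (V * W) + suc V)         ≡⟨ cong (s +_) (+-comm (suc (V * W)) (suc V)) ⟩
      s + (suc V + suc (V * W))         ≡⟨ cong (s +_) (cong suc (+-suc V (V * W))) ⟩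
      s + (2 + (V + V * W))             ∎
      where open ≤-Reasoning

-- Iterating a definable operator

nonzero : ℕ → Bool
nonzero zero    = false
nonzero (suc _) = true

γ₀ : ℕ → Env
γ₀ ℓ zero    = ℓ
γ₀ ℓ (suc _) = 0

zs₀ : ℕ → List ℕ
zs₀ ℓ = ℓ ∷ List.replicate 19 0

At-replicate : ∀ {n} (y : Fin n) → At (List.replicate n 0) (toℕ y) 0
At-replicate zero    = here
At-replicate (suc y) = there (At-replicate y)

Sees₀ : ∀ ℓ → Sees toℕ (γ₀ ℓ) (zs₀ ℓ)
Sees₀ ℓ zero    = here
Sees₀ ℓ (suc y) = there (At-replicate y)

γ₀≤ : ∀ ℓ y → γ₀ ℓ y ≤ ℓ
γ₀≤ ℓ zero    = ≤-refl
γ₀≤ ℓ (suc y) = z≤n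

-- Bits appear in the order in which the loop pushes them, the last index on top; the reversal by
-- `pour` puts bit `i` at position `i`.
fill : (ℕ → Bool) → ℕ → List Bool
fill f zero    = []
fill f (suc n) = f n ∷ fill f n

length-fill : ∀ f n → length (fill f n) ≡ n
length-fill f zero    = refl
length-fill f (suc n) = cong suc (length-fill f n)

get-fill : ∀ f n ys i → i < n → get (fill f n ʳ++ ys) i ≡ f i
get-fill-beyond : ∀ f n ys i → get (fill f n ʳ++ ys) (n + i) ≡ get ys i
get-fill f (suc n) ys i i<1+n with m≤n⇒m<n∨m≡n (≤-pred i<1+n)
... | inj₁ i<n  = get-fill f n (f n ∷ ys) i i<n
... | inj₂ refl = subst (λ j → get (fill f i ʳ++ (f i ∷ ys)) j ≡ f i) (+-identityʳ i)
  (get-fill-beyond f i (f i ∷ ys) 0)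
get-fill-beyond f zero    ys i = refl
get-fill-beyond f (suc n) ys i = trans (cong (get (fill f n ʳ++ (f n ∷ ys))) (sym (+-suc n i)))
  (get-fill-beyond f n (f n ∷ ys) (suc i))

-- A scheme describes the iteration of a definable operator: a word is
-- replaced `rounds` times by the word of length `cells` whose i-th bit is
-- the value of `cell` at i, and then `verdict` is evaluated.
record Scheme : Set where
  field
    cells rounds cell verdict : Exp

module _ (𝒮 : Scheme) (ℓ : ℕ) where
  open Scheme 𝒮

  cellAt : List Bool → ℕ → Bool
  cellAt M i = nonzero (⟦ cell ⟧ M (γ₀ ℓ [ 1F ≔ i ]))

  next : List Bool → List Bool
  next M = fill (cellAt M) (⟦ cells ⟧ M (γ₀ ℓ)) ʳ++ []

  iterateNext : ℕ → List Bool → List Bool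
  iterateNext zero    M = M
  iterateNext (suc r) M = next (iterateNext r M)

result : Scheme → List Bool → Bool
result 𝒮 w = nonzero (⟦ verdict ⟧ (iterateNext 𝒮 ℓ (⟦ rounds ⟧ w (γ₀ ℓ)) w) (γ₀ ℓ))
  where
  open Scheme 𝒮
  ℓ = length w

module Machine (𝒮 : Scheme) where
  open Scheme 𝒮

  D : ℕ
  D = depth cells ⊔ depth cell ⊔ depth rounds ⊔ depth verdict

  zeros : ∀ {k} → ℕ → Program (8 + k)
  zeros zero    = skip
  zeros (suc n) = zeros n ⨾ literal 0

  setup : ∀ {k} → Program (8 + k)
  setup = zeros 20 ⨾
    -- Every bit moved adds one to the topmost of the twenty zeros, which thus becomes the length of
    -- the input.
    while mem (case mem skip (pop mem ⨾ push aux false ⨾ push num true)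
                             (pop mem ⨾ push aux true ⨾ push num true)) ⨾
    pour aux mem

  ρ₁ : Env
  ρ₁ = (suc ∘ toℕ) [ 1F ≔ 0 ]

  round : Program (9 + D)
  round = lift (comp cells D toℕ) ⨾ unload ⨾ spend cnt (push counter true) ⨾ literal 0 ⨾
    spend counter (lift (comp cell D ρ₁) ⨾ unload ⨾
      case cnt (push new false) (push new true) (push new true) ⨾
      spend cnt skip ⨾ push num true) ⨾
    discard ⨾ while mem (pop mem) ⨾ pour new mem

  -- `lift` adds a counter of rounds to `round`, which already has a counter of cells: two registers
  -- besides the `D` that the expressions ask for.
  main : Program (10 + D)
  main = setup ⨾ comp rounds (2 + D) toℕ ⨾ unload ⨾ spend cnt (push counter true) ⨾
    spend counter (lift round) ⨾
    comp verdict (2 + D) toℕ ⨾ unload ⨾ case cnt (push mem false) (push mem true) (push mem true)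

  Mem S S₁ S₂ setupP roundP mainP : Pol
  Mem = arg ⊕ valP cells
  -- Twenty terminators and the one nonzero number `ℓ`; `Mem` bounds this number as well as the
  -- memory.
  S  = con 20 ⊕ Mem
  S₁ = S ⊕ (con 1 ⊕ valP cells)
  S₂ = valP cell ⊚ (arg ⊕ valP cells)
  setupP = con 21 ⊕ ((con 1 ⊕ arg ⊗ con 5) ⊕ (con 1 ⊕ arg ⊗ con 4))
  roundP = costP cells toℕ ⊚ S ⊕ (unloadP ⊚ valP cells ⊕ (spendP (con 2) ⊚ valP cells ⊕ (con 1 ⊕
    ((con 1 ⊕ valP cells ⊗ (con 1 ⊕ (con 1 ⊕ (costP cell ρ₁ ⊚ S₁ ⊕ (unloadP ⊚ S₂ ⊕ (con 2 ⊕ (spendP (con 2) ⊚ S₂ ⊕ con 1))))))) ⊕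
     (discardP ⊚ valP cells ⊕ ((con 1 ⊕ Mem ⊗ con 2) ⊕ (con 1 ⊕ valP cells ⊗ con 4)))))))
  mainP = setupP ⊕ (costP rounds toℕ ⊚ S ⊕ (unloadP ⊚ valP rounds ⊕ (spendP (con 2) ⊚ valP rounds ⊕
    ((con 1 ⊕ valP rounds ⊗ (con 1 ⊕ (con 1 ⊕ roundP))) ⊕
     (costP verdict toℕ ⊚ S ⊕ (unloadP ⊚ valP verdict ⊕ con 2))))))

  cells≤ : depth cells ≤ D
  cells≤ = ≤-trans (m≤m⊔n (depth cells) (depth cell))
    (≤-trans (m≤m⊔n _ (depth rounds)) (m≤m⊔n _ (depth verdict)))
  cell≤ : depth cell ≤ D
  cell≤ = ≤-trans (m≤n⊔m (depth cells) (depth cell))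
    (≤-trans (m≤m⊔n _ (depth rounds)) (m≤m⊔n _ (depth verdict)))
  rounds≤ : depth rounds ≤ 2 + D
  rounds≤ = m≤n⇒m≤o+n 2 (≤-trans (m≤n⊔m (depth cells ⊔ depth cell) (depth rounds)) (m≤m⊔n _ (depth verdict)))
  verdict≤ : depth verdict ≤ 2 + D
  verdict≤ = m≤n⇒m≤o+n 2 (m≤n⊔m (depth cells ⊔ depth cell ⊔ depth rounds) (depth verdict))

  module Run (w : List Bool) where
    ℓ : ℕ
    ℓ = length w

    step-length : ∀ M → length (next 𝒮 ℓ M) ≤ evalP (valP cells) ℓ
    step-length M = begin
      length (next 𝒮 ℓ M)     ≡⟨ length-ʳ++ (fill (cellAt 𝒮 ℓ M) (⟦ cells ⟧ M (γ₀ ℓ))) ⟩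
      length (fill (cellAt 𝒮 ℓ M) (⟦ cells ⟧ M (γ₀ ℓ))) + 0  ≡⟨ +-identityʳ _ ⟩
      length (fill (cellAt 𝒮 ℓ M) (⟦ cells ⟧ M (γ₀ ℓ)))      ≡⟨ length-fill _ (⟦ cells ⟧ M (γ₀ ℓ)) ⟩
      ⟦ cells ⟧ M (γ₀ ℓ)       ≤⟨ value-≤ cells (γ₀≤ ℓ) ⟩
      evalP (valP cells) ℓ     ∎
      where open ≤-Reasoning

    memory : ℕ → List Bool
    memory r = iterateNext 𝒮 ℓ r w

    -- The value bound of `cells` depends on `ℓ` only, not on the current word, so the bound does
    -- not grow from round to round.
    memory-length : ∀ r → length (memory r) ≤ evalP Mem ℓ
    memory-length zero    = m≤m+n ℓ _
    memory-length (suc r) = m≤n⇒m≤o+n ℓ (step-length (memory r))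

    s : ℕ
    s = evalP S ℓ

    zs₀≤ : size (zs₀ ℓ) ≤ s
    zs₀≤ = begin
      suc ℓ + 19            ≡⟨ +-comm (suc ℓ) 19 ⟩
      19 + suc ℓ            ≡⟨ +-suc 19 ℓ ⟩
      20 + ℓ                ≤⟨ +-monoʳ-≤ 20 (m≤m+n ℓ _) ⟩
      20 + evalP Mem ℓ      ∎
      where open ≤-Reasoning

    memory≤s : ∀ r → length (memory r) ≤ s
    memory≤s r = m≤n⇒m≤o+n 20 (memory-length r)

    clear-run : ∀ {k} M {U N} {cs : Store k} {n} → length M ≤ n →
      while mem (pop mem) ∣ full M [] U N [] [] [] [] cs ⇓≤[ 1 + n * 2 ] full [] [] U N [] [] [] [] cs
    clear-run [] _ = relax (s≤s z≤n) (whileDone refl)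
    clear-run (_ ∷ M) {n = suc n} (s≤s h) = whileStep refl pops (clear-run M h)

    zeros-run : ∀ {k} n {M} {cs : Store k} →
      zeros n ∣ full M [] [] [] [] [] [] [] cs ⇓≤[ 1 + n * 1 ]
        full M [] [] (enc (List.replicate n 0)) [] [] [] [] cs
    zeros-run zero    = skips
    zeros-run (suc n) = relax (≤-reflexive (cong suc (+-comm (n * 1) 1))) (zeros-run n then pushes)

    setup-run : ∀ {k} {cs : Store k} →
      setup ∣ full w [] [] [] [] [] [] [] cs ⇓≤[ evalP setupP ℓ ]
        full w [] [] (enc (zs₀ ℓ)) [] [] [] [] cs
    setup-run {cs = cs} = zeros-run 20
      then into (cong (λ n → full [] (w ʳ++ []) [] (enc (n ∷ List.replicate 19 0)) [] [] [] [] cs) (+-identityʳ ℓ))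
        (count w [] 0)
      then into (cong (λ M → full M [] [] (enc (zs₀ ℓ)) [] [] [] [] cs)
        (trans (ʳ++-ʳ++ w) (++-identityʳ w)))
        (pour-run (λ x y → full y x [] (enc (zs₀ ℓ)) [] [] [] [] cs) refl refl refl (w ʳ++ []) []
          (≤-reflexive (trans (length-ʳ++ w) (+-identityʳ ℓ))))
      where
      count : ∀ xs ys n → while mem (case mem skip (pop mem ⨾ push aux false ⨾ push num true)
                                        (pop mem ⨾ push aux true ⨾ push num true)) ∣
        full xs ys [] (enc (n ∷ List.replicate 19 0)) [] [] [] [] cs ⇓≤[ 1 + length xs * 5 ]
        full [] (xs ʳ++ ys) [] (enc (length xs + n ∷ List.replicate 19 0)) [] [] [] [] cs
      count [] ys n = whileDone refl
      count (false ∷ xs) ys n =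
        into (cong (λ m → full [] (xs ʳ++ (false ∷ ys)) [] (enc (m ∷ List.replicate 19 0)) [] [] [] [] cs) (+-suc (length xs) n))
          (whileStep refl (caseFalse refl (pops then pushes then pushes)) (count xs (false ∷ ys) (suc n)))
      count (true ∷ xs) ys n =
        into (cong (λ m → full [] (xs ʳ++ (true ∷ ys)) [] (enc (m ∷ List.replicate 19 0)) [] [] [] [] cs) (+-suc (length xs) n))
          (whileStep refl (caseTrue refl (pops then pushes then pushes)) (count xs (true ∷ ys) (suc n)))

    round-run : ∀ M → length M ≤ evalP Mem ℓ →
      round ∣ full M [] [] (enc (zs₀ ℓ)) [] [] [] [] (empties (suc D)) ⇓≤[ evalP roundP ℓ ]
        full (next 𝒮 ℓ M) [] [] (enc (zs₀ ℓ)) [] [] [] [] (empties (suc D))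
    round-run M M≤ =
      lift-run [] (comp-run cells D cells≤ (Sees₀ ℓ) zs₀≤ M≤s)
      then unload-run n≤V
      then while-run (λ r v → full M [] [] (enc (zs₀ ℓ)) [] (ones r []) [] [] (ones v [] ∷ empties D))
        refl refl (λ _ _ _ → pops then pushes) n≤V
      then pushes
      then while-run (λ r v → full M [] (fill f v) (enc (v ∷ zs₀ ℓ)) [] [] [] [] (ones r [] ∷ empties D))
        refl refl
        (λ r v eq → pops
          then lift-run (ones r []) (comp-run cell D cell≤ (Sees-≔ 1F (Sees-under (Sees₀ ℓ)) here)
            (≤-trans (+-mono-≤ (s≤s (v≤V r v eq)) zs₀≤) (≤-reflexive (+-comm (1 + V) s)))
            (≤-trans M≤s (m≤m+n s _)))
          then unload-run (value≤ r v eq)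
          then emit (⟦ cell ⟧ M (γ₀ ℓ [ 1F ≔ v ])) r v
          then while-run (λ r′ _ → full M [] (fill f (suc v)) (enc (v ∷ zs₀ ℓ)) [] (ones r′ []) [] [] (ones r [] ∷ empties D))
            refl refl (λ _ _ _ → pops then skips) (value≤ r v eq)
          then pushes)
        n≤V
      then discard-run {zs = zs₀ ℓ} n≤V
      then clear-run M M≤
      then pour-run (λ x y → full y [] x (enc (zs₀ ℓ)) [] [] [] [] ([] ∷ empties D)) refl refl refl
        (fill f n) [] (≤-trans (≤-reflexive (length-fill f n)) n≤V)
      where
      V = evalP (valP cells) ℓ
      n = ⟦ cells ⟧ M (γ₀ ℓ)
      f = cellAt 𝒮 ℓ M
      M≤s : length M ≤ s
      M≤s = m≤n⇒m≤o+n 20 M≤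
      n≤V : n ≤ V
      n≤V = value-≤ cells (γ₀≤ ℓ)
      v≤V : ∀ r v → v + suc r ≡ n → v ≤ V
      v≤V r v eq = ≤-trans (subst (v ≤_) eq (m≤m+n v (suc r))) n≤V
      value≤ : ∀ r v → v + suc r ≡ n → ⟦ cell ⟧ M (γ₀ ℓ [ 1F ≔ v ]) ≤ evalP S₂ ℓ
      value≤ r v eq = value-≤ cell (≔-≤ 1F (λ y → m≤n⇒m≤n+o V (γ₀≤ ℓ y)) (m≤n⇒m≤o+n ℓ (v≤V r v eq)))
      emit : ∀ c r v → case cnt (push new false) (push new true) (push new true) ∣
        full M [] (fill f v) (enc (v ∷ zs₀ ℓ)) [] (ones c []) [] [] (ones r [] ∷ empties D) ⇓≤[ 2 ]
        full M [] (nonzero c ∷ fill f v) (enc (v ∷ zs₀ ℓ)) [] (ones c []) [] [] (ones r [] ∷ empties D)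
      emit zero    r v = caseEmpty refl pushes
      emit (suc c) r v = caseTrue refl pushes

    R : ℕ
    R = ⟦ rounds ⟧ w (γ₀ ℓ)

    final : Store (10 + D)
    final = full (result 𝒮 w ∷ memory R) [] [] (enc (zs₀ ℓ)) []
      (ones (⟦ verdict ⟧ (memory R) (γ₀ ℓ)) []) [] [] (empties (2 + D))

    main-run : main ∣ initial w ⇓≤[ evalP mainP ℓ ] final
    main-run = setup-run
      then comp-run rounds (2 + D) rounds≤ (Sees₀ ℓ) zs₀≤ (memory≤s 0)
      then unload-run R≤
      then while-run (λ r x → full w [] [] (enc (zs₀ ℓ)) [] (ones r []) [] [] (ones x [] ∷ empties (suc D)))
        refl refl (λ _ _ _ → pops then pushes) R≤
      then while-run (λ r x → full (memory x) [] [] (enc (zs₀ ℓ)) [] [] [] [] (ones r [] ∷ empties (suc D)))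
        refl refl (λ r x _ → pops then lift-run (ones r []) (round-run (memory x) (memory-length x))) R≤
      then comp-run verdict (2 + D) verdict≤ (Sees₀ ℓ) zs₀≤ (memory≤s R)
      then unload-run (value-≤ verdict (γ₀≤ ℓ))
      then output (⟦ verdict ⟧ (memory R) (γ₀ ℓ))
      where
      R≤ : R ≤ evalP (valP rounds) ℓ
      R≤ = value-≤ rounds (γ₀≤ ℓ)
      output : ∀ c → case cnt (push mem false) (push mem true) (push mem true) ∣
        full (memory R) [] [] (enc (zs₀ ℓ)) [] (ones c []) [] [] (empties (2 + D)) ⇓≤[ 2 ]
        full (nonzero c ∷ memory R) [] [] (enc (zs₀ ℓ)) [] (ones c []) [] [] (empties (2 + D))
      output zero    = caseEmpty refl pushes
      output (suc c) = caseTrue refl pushes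

scheme-decides : ∀ {A : Set} {encode : A → List Bool} {Promise Yes : A → Set} (𝒮 : Scheme) →
  (∀ x → Promise x → Reflects (Yes x) (result 𝒮 (encode x))) →
  PolyTimeDecidable encode Promise Yes
scheme-decides {encode = encode} 𝒮 correct =
  9 + D , main , proj₁ bound , proj₁ (proj₂ bound) , λ x x∈P →
    let (n , n≤ , d) = Run.main-run (encode x)
    in n , Run.final (encode x) , result 𝒮 (encode x) , d ,
       ≤-trans n≤ (proj₂ (proj₂ bound) _) , (_ , refl) , correct x x∈P
  where
  open Machine 𝒮
  bound = evalP-bounded mainP

-- Formulas

infix 5 _≤ᶠ_ _≡ᶠ_
infixr 3 _∧ᶠ_
infixr 2 _⇒ᶠ_

-- `⋀ᶠ` is unfolded at compile time. Unlike a quantified variable, its index is a fixed number, as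
-- `digitᵉ` demands for the position of a digit.
data Fm : Set where
  _≤ᶠ_ _≡ᶠ_ : Exp → Exp → Fm
  bitᶠ      : Exp → Fm
  _∧ᶠ_ _⇒ᶠ_ : Fm → Fm → Fm
  ∀ᶠ ∃ᶠ     : Name → Exp → Fm → Fm
  letᶠ      : Name → Exp → Fm → Fm
  ⋀ᶠ        : ℕ → (ℕ → Fm) → Fm

Holds : Fm → List Bool → Env → Set
Holds (a ≤ᶠ b)     M γ = ⟦ a ⟧ M γ ≤ ⟦ b ⟧ M γ
Holds (a ≡ᶠ b)     M γ = ⟦ a ⟧ M γ ≡ ⟦ b ⟧ M γ
Holds (bitᶠ a)     M γ = T (get M (⟦ a ⟧ M γ))
Holds (f ∧ᶠ g)     M γ = Holds f M γ × Holds g M γ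
Holds (f ⇒ᶠ g)     M γ = Holds f M γ → Holds g M γ
Holds (∀ᶠ x a f)   M γ = ∀ v → v < ⟦ a ⟧ M γ → Holds f M (γ [ x ≔ v ])
Holds (∃ᶠ x a f)   M γ = ∃[ v ] (v < ⟦ a ⟧ M γ × Holds f M (γ [ x ≔ v ]))
Holds (letᶠ x a f) M γ = Holds f M (γ [ x ≔ ⟦ a ⟧ M γ ])
Holds (⋀ᶠ k F)     M γ = ∀ a → a < k → Holds (F a) M γ

-- True means nonzero, so that `∃ᶠ` may count its witnesses. With `lit 1 ∸ᵉ` as negation, universal
-- quantifiers and implications are rendered classically, by excluding counterexamples.
⌜_⌝ : Fm → Exp
⌜⋀⌝ : ℕ → (ℕ → Fm) → Exp

⌜ a ≤ᶠ b ⌝     = lit 1 ∸ᵉ (a ∸ᵉ b)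
⌜ a ≡ᶠ b ⌝     = lit 1 ∸ᵉ ((a ∸ᵉ b) +ᵉ (b ∸ᵉ a))
⌜ bitᶠ a ⌝     = bit a
⌜ f ∧ᶠ g ⌝     = ⌜ f ⌝ *ᵉ ⌜ g ⌝
⌜ f ⇒ᶠ g ⌝     = lit 1 ∸ᵉ ⌜ f ⌝ *ᵉ (lit 1 ∸ᵉ ⌜ g ⌝)
⌜ ∀ᶠ x a f ⌝   = lit 1 ∸ᵉ sumᵉ x a (lit 1 ∸ᵉ ⌜ f ⌝)
⌜ ∃ᶠ x a f ⌝   = sumᵉ x a ⌜ f ⌝
⌜ letᶠ x a f ⌝ = letᵉ x a ⌜ f ⌝
⌜ ⋀ᶠ k F ⌝     = ⌜⋀⌝ k F

⌜⋀⌝ zero    F = lit 1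
⌜⋀⌝ (suc k) F = ⌜ F k ⌝ *ᵉ ⌜⋀⌝ k F

infix 4 _decides_

_decides_ : ℕ → Set → Set
n decides P = Reflects P (nonzero n)

decides-⇔ : ∀ {P Q} n → (P → Q) → (Q → P) → n decides P → n decides Q
decides-⇔ zero    f g (ofⁿ ¬p) = ofⁿ (¬p ∘ g)
decides-⇔ (suc n) f g (ofʸ p)  = ofʸ (f p)

decides-¬ : ∀ {P} n → n decides P → (1 ∸ n) decides (¬ P)
decides-¬ zero    (ofⁿ ¬p) = ofʸ ¬p
decides-¬ (suc n) (ofʸ p)  rewrite 0∸n≡0 n = ofⁿ (λ ¬p → ¬p p)

decides-× : ∀ {P Q} m n → m decides P → n decides Q → (m * n) decides (P × Q)
decides-× zero    n       (ofⁿ ¬p) _        = ofⁿ (¬p ∘ proj₁)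
decides-× (suc m) zero    (ofʸ p)  (ofⁿ ¬q) rewrite *-zeroʳ m = ofⁿ (¬q ∘ proj₂)
decides-× (suc m) (suc n) (ofʸ p)  (ofʸ q)  = ofʸ (p , q)

-- Decidability supplies the double negation elimination that the classical rendering of `∀ᶠ` and
-- `⇒ᶠ` calls for.
decides-stable : ∀ {P} n → n decides P → ¬ ¬ P → P
decides-stable zero    (ofⁿ ¬p) ¬¬p = ⊥-elim (¬¬p ¬p)
decides-stable (suc n) (ofʸ p)  _   = p

decides-≤ : ∀ m n → (1 ∸ (m ∸ n)) decides (m ≤ n)
decides-≤ m n with m ∸ n in eq
... | zero  = ofʸ (m∸n≡0⇒m≤n eq)
... | suc k rewrite 0∸n≡0 k = ofⁿ (λ m≤n → 0≢1+n (trans (sym (m≤n⇒m∸n≡0 m≤n)) eq))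

decides-≡ : ∀ m n → (1 ∸ ((m ∸ n) + (n ∸ m))) decides (m ≡ n)
decides-≡ m n with (m ∸ n) + (n ∸ m) in eq
... | zero  = ofʸ (≤-antisym (m∸n≡0⇒m≤n (m+n≡0⇒m≡0 (m ∸ n) eq)) (m∸n≡0⇒m≤n (m+n≡0⇒n≡0 (m ∸ n) eq)))
... | suc k rewrite 0∸n≡0 k = ofⁿ (λ { refl → 0≢1+n (trans (sym (cong₂ _+_ (n∸n≡0 m) (n∸n≡0 m))) eq) })

decides-T : ∀ b → b2n b decides T b
decides-T true  = ofʸ tt
decides-T false = ofⁿ id

decides-∃ : ∀ n (f : ℕ → ℕ) {P : ℕ → Set} → (∀ v → f v decides P v) → Σ< n f decides (∃[ v ] (v < n × P v))
decides-∃ zero    f h = ofⁿ λ { (_ , () , _) }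
decides-∃ (suc n) f h with f n | h n
... | suc _ | ofʸ p  = ofʸ (n , ≤-refl , p)
... | zero  | ofⁿ ¬p = decides-⇔ (Σ< n f)
  (λ { (v , v<n , p) → v , m≤n⇒m≤1+n v<n , p }) narrow (decides-∃ n f h)
  where
  narrow : _
  narrow (v , v<1+n , p) with m≤n⇒m<n∨m≡n (≤-pred v<1+n)
  ... | inj₁ v<n  = v , v<n , p
  ... | inj₂ refl = ⊥-elim (¬p p)

decides-∀ : ∀ n (f : ℕ → ℕ) {P : ℕ → Set} → (∀ v → f v decides P v) →
            (1 ∸ Σ< n (λ v → 1 ∸ f v)) decides (∀ v → v < n → P v)
decides-∀ n f h = decides-⇔ (1 ∸ Σ< n (λ v → 1 ∸ f v))
  (λ ¬∃ v v<n → decides-stable (f v) (h v) (λ ¬p → ¬∃ (v , v<n , ¬p)))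
  (λ all (v , v<n , ¬p) → ¬p (all v v<n))
  (decides-¬ (Σ< n (λ v → 1 ∸ f v)) (decides-∃ n (λ v → 1 ∸ f v) (λ v → decides-¬ (f v) (h v))))

⌜⌝-decides : ∀ f M γ → ⟦ ⌜ f ⌝ ⟧ M γ decides Holds f M γ
⌜⋀⌝-decides : ∀ k F M γ → ⟦ ⌜⋀⌝ k F ⟧ M γ decides Holds (⋀ᶠ k F) M γ

⌜⌝-decides (a ≤ᶠ b)     M γ = decides-≤ (⟦ a ⟧ M γ) (⟦ b ⟧ M γ)
⌜⌝-decides (a ≡ᶠ b)     M γ = decides-≡ (⟦ a ⟧ M γ) (⟦ b ⟧ M γ)
⌜⌝-decides (bitᶠ a)     M γ = decides-T (get M (⟦ a ⟧ M γ))
⌜⌝-decides (f ∧ᶠ g)     M γ =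
  decides-× (⟦ ⌜ f ⌝ ⟧ M γ) (⟦ ⌜ g ⌝ ⟧ M γ) (⌜⌝-decides f M γ) (⌜⌝-decides g M γ)
⌜⌝-decides (f ⇒ᶠ g)     M γ = decides-⇔ (1 ∸ m * (1 ∸ n))
  (λ ¬[f×¬g] f → decides-stable n (⌜⌝-decides g M γ) (λ ¬g → ¬[f×¬g] (f , ¬g)))
  (λ f⇒g (f , ¬g) → ¬g (f⇒g f))
  (decides-¬ (m * (1 ∸ n))
    (decides-× m (1 ∸ n) (⌜⌝-decides f M γ) (decides-¬ n (⌜⌝-decides g M γ))))
  where
  m = ⟦ ⌜ f ⌝ ⟧ M γ
  n = ⟦ ⌜ g ⌝ ⟧ M γ
⌜⌝-decides (∀ᶠ x a f)   M γ =
  decides-∀ (⟦ a ⟧ M γ) (λ v → ⟦ ⌜ f ⌝ ⟧ M (γ [ x ≔ v ])) (λ v → ⌜⌝-decides f M (γ [ x ≔ v ]))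
⌜⌝-decides (∃ᶠ x a f)   M γ =
  decides-∃ (⟦ a ⟧ M γ) (λ v → ⟦ ⌜ f ⌝ ⟧ M (γ [ x ≔ v ])) (λ v → ⌜⌝-decides f M (γ [ x ≔ v ]))
⌜⌝-decides (letᶠ x a f) M γ = ⌜⌝-decides f M (γ [ x ≔ ⟦ a ⟧ M γ ])
⌜⌝-decides (⋀ᶠ k F)     M γ = ⌜⋀⌝-decides k F M γ

⌜⋀⌝-decides zero    F M γ = ofʸ (λ _ ())
⌜⋀⌝-decides (suc k) F M γ = decides-⇔ (⟦ ⌜ F k ⌝ ⟧ M γ * ⟦ ⌜⋀⌝ k F ⟧ M γ)
  to (λ h → h k ≤-refl , λ a a<k → h a (m≤n⇒m≤1+n a<k))
  (decides-× (⟦ ⌜ F k ⌝ ⟧ M γ) (⟦ ⌜⋀⌝ k F ⟧ M γ) (⌜⌝-decides (F k) M γ) (⌜⋀⌝-decides k F M γ))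
  where
  to : Holds (F k) M γ × (∀ a → a < k → Holds (F a) M γ) → ∀ a → a < suc k → Holds (F a) M γ
  to (hk , h) a a<1+k with m≤n⇒m<n∨m≡n (≤-pred a<1+k)
  ... | inj₁ a<k  = h a a<k
  ... | inj₂ refl = hk

Σ<-cong : ∀ n {f g : ℕ → ℕ} → (∀ v → v < n → f v ≡ g v) → Σ< n f ≡ Σ< n g
Σ<-cong zero    h = refl
Σ<-cong (suc n) h = cong₂ _+_ (h n ≤-refl) (Σ<-cong n (λ v v<n → h v (m≤n⇒m≤1+n v<n)))

-- Numbers are found by counting instead of searching: quotients and the orders of the two graphs
-- are thresholds of decidable properties.
Σ<-threshold : ∀ N k f → k ≤ N → (∀ v → v < N → v < k → f v ≡ 1) → (∀ v → v < N → k ≤ v → f v ≡ 0) →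
               Σ< N f ≡ k
Σ<-threshold zero    .zero f z≤n below above = refl
Σ<-threshold (suc N) k f k≤1+N below above with m≤n⇒m<n∨m≡n k≤1+N
... | inj₁ k<1+N = cong₂ _+_ (above N ≤-refl (≤-pred k<1+N))
  (Σ<-threshold N k f (≤-pred k<1+N) (λ v v<N → below v (m≤n⇒m≤1+n v<N)) (λ v v<N → above v (m≤n⇒m≤1+n v<N)))
... | inj₂ refl = cong₂ _+_ (below N ≤-refl ≤-refl)
  (Σ<-threshold N N f ≤-refl (λ v v<N _ → below v (m≤n⇒m≤1+n v<N) (m≤n⇒m≤1+n v<N))
    (λ v v<N N≤v → ⊥-elim (<⇒≱ v<N N≤v)))

1∸-decides-yes : ∀ {P : Set} n → (1 ∸ n) decides P → P → 1 ∸ n ≡ 1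
1∸-decides-yes zero    _         p = refl
1∸-decides-yes (suc n) d p rewrite 0∸n≡0 n with d
... | ofⁿ ¬p = ⊥-elim (¬p p)

decides-no : ∀ {P : Set} n → n decides P → ¬ P → n ≡ 0
decides-no zero    _       _  = refl
decides-no (suc n) (ofʸ p) ¬p = ⊥-elim (¬p p)

-- Digits and encodings

-- The quotient counts the positive multiples of `b` that are at most `x`; for positive `b` there
-- are at most `x` of them, hence the range of the sum. In this form it is by computation the value
-- of `quoᵉ`.
quo rem : ℕ → ℕ → ℕ
quo x b = Σ< x (λ y → 1 ∸ ((y + 1) * b ∸ x))
rem x b = x ∸ quo x b * b

quo-≡ : ∀ q {r b} → r < b → quo (q * b + r) b ≡ q
quo-≡ q {r} {b@(suc _)} r<b = Σ<-threshold (q * b + r) q _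
  (≤-trans (m≤m*n q b) (m≤m+n _ r)) below above
  where
  below : ∀ v → v < q * b + r → v < q → 1 ∸ ((v + 1) * b ∸ (q * b + r)) ≡ 1
  below v _ v<q rewrite m≤n⇒m∸n≡0 (≤-trans (*-monoˡ-≤ b (subst (_≤ q) (+-comm 1 v) v<q)) (m≤m+n (q * b) r)) = refl
  above : ∀ v → v < q * b + r → q ≤ v → 1 ∸ ((v + 1) * b ∸ (q * b + r)) ≡ 0
  above v _ q≤v = m≤n⇒m∸n≡0 (m<n⇒0<n∸m (begin-strict
    q * b + r    <⟨ +-mono-≤-< (*-monoˡ-≤ b q≤v) r<b ⟩
    v * b + b    ≡⟨ +-comm (v * b) b ⟩
    (1 + v) * b  ≡⟨ cong (_* b) (+-comm 1 v) ⟩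
    (v + 1) * b  ∎))
    where open ≤-Reasoning

rem-≡ : ∀ q {r b} → r < b → rem (q * b + r) b ≡ r
rem-≡ q {r} {b} r<b rewrite quo-≡ q r<b = m+n∸m≡n (q * b) r

rem-< : ∀ x {b} → 0 < b → rem x b < b
rem-< x {b@(suc _)} _ = subst (_< b) (sym (trans (cong (λ y → rem y b) split) (rem-≡ (x / b) (m%n<n x b))))
  (m%n<n x b)
  where
  split : x ≡ (x / b) * b + x % b
  split = trans (m≡m%n+[m/n]*n x b) (+-comm (x % b) _)

digit : ℕ → ℕ → ℕ → ℕ
digit b zero    x = rem x b
digit b (suc a) x = digit b a (quo x b)

code : ℕ → ℕ → (ℕ → ℕ) → ℕ
code b zero    s = 0
code b (suc k) s = code b k (s ∘ suc) * b + s 0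

digit-< : ∀ {b} a x → 0 < b → digit b a x < b
digit-< zero    x 0<b = rem-< x 0<b
digit-< (suc a) x 0<b = digit-< a _ 0<b

digit-code : ∀ {b} k s a → a < k → (∀ i → i < k → s i < b) → digit b a (code b k s) ≡ s a
digit-code (suc k) s zero    _       h = rem-≡ (code _ k (s ∘ suc)) (h 0 (s≤s z≤n))
digit-code {b} (suc k) s (suc a) (s≤s a<k) h =
  trans (cong (digit b a) (quo-≡ (code b k (s ∘ suc)) (h 0 (s≤s z≤n))))
    (digit-code k (s ∘ suc) a a<k (λ i i<k → h (suc i) (s≤s i<k)))

*+-< : ∀ {p q m b} → p < m → q < b → p * b + q < m * b
*+-< {p} {q} {m} {b} p<m q<b = begin-strict
  p * b + q    <⟨ +-monoʳ-< (p * b) q<b ⟩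
  p * b + b    ≡⟨ +-comm (p * b) b ⟩
  suc p * b    ≤⟨ *-monoˡ-≤ b p<m ⟩
  m * b        ∎
  where open ≤-Reasoning

code-< : ∀ {b} k s → (∀ i → i < k → s i < b) → code b k s < b ^ k
code-< zero    s h = s≤s z≤n
code-< {b} (suc k) s h = subst (code b (suc k) s <_) (*-comm (b ^ k) b)
  (*+-< (code-< k (s ∘ suc) (λ i i<k → h (suc i) (s≤s i<k))) (h 0 (s≤s z≤n)))

-- Positions of bits in the encoded input

get-ones-below : ∀ n {ys} x → x < n → get (List.replicate n true ++ ys) x ≡ true
get-ones-below (suc n) zero    _         = refl
get-ones-below (suc n) (suc x) (s≤s x<n) = get-ones-below n x x<n

get-ones-beyond : ∀ n {ys} y → get (List.replicate n true ++ ys) (n + y) ≡ get ys y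
get-ones-beyond zero    y = refl
get-ones-beyond (suc n) y = get-ones-beyond n y

get-tabulate : ∀ {n} (f : Fin n → Bool) {ys} v → get (List.tabulate f ++ ys) (toℕ v) ≡ f v
get-tabulate f zero    = refl
get-tabulate f (suc v) = get-tabulate (f ∘ suc) v

get-tabulate-beyond : ∀ {n} (f : Fin n → Bool) {ys} y → get (List.tabulate f ++ ys) (n + y) ≡ get ys y
get-tabulate-beyond {zero}  f y = refl
get-tabulate-beyond {suc n} f y = get-tabulate-beyond (f ∘ suc) y

rows : ∀ {k n} → (Fin k → Fin n → Bool) → List Bool
rows f = List.concat (List.tabulate (λ u → List.tabulate (f u)))

get-rows : ∀ {k n} (f : Fin k → Fin n → Bool) {ys} u v → get (rows f ++ ys) (toℕ u * n + toℕ v) ≡ f u v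
get-rows f {ys} zero v
  rewrite ++-assoc (List.tabulate (f zero)) (rows (f ∘ suc)) ys = get-tabulate (f zero) v
get-rows {n = n} f {ys} (suc u) v
  rewrite ++-assoc (List.tabulate (f zero)) (rows (f ∘ suc)) ys | +-assoc n (toℕ u * n) (toℕ v) =
  trans (get-tabulate-beyond (f zero) (toℕ u * n + toℕ v)) (get-rows (f ∘ suc) u v)

get-rows-beyond : ∀ {k n} (f : Fin k → Fin n → Bool) {ys} y → get (rows f ++ ys) (k * n + y) ≡ get ys y
get-rows-beyond {zero}  f y = refl
get-rows-beyond {suc k} {n} f {ys} y
  rewrite ++-assoc (List.tabulate (f zero)) (rows (f ∘ suc)) ys | +-assoc n (k * n) y =
  trans (get-tabulate-beyond (f zero) (k * n + y)) (get-rows-beyond (f ∘ suc) y)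

length-rows : ∀ {k n} (f : Fin k → Fin n → Bool) → length (rows f) ≡ k * n
length-rows {zero}  f = refl
length-rows {suc k} f = trans (length-++ (List.tabulate (f zero)))
  (cong₂ _+_ (length-tabulate (f zero)) (length-rows (f ∘ suc)))

module _ (G : Graph) {ys : List Bool} where
  private n = order G

  encoding : List Bool
  encoding = encodeGraph G ++ ys

  encoding-≡ : encoding ≡ List.replicate n true ++ false ∷ (rows (adj G) ++ ys)
  encoding-≡ = ++-assoc (List.replicate n true) (false ∷ rows (adj G)) ys

  get-encoding-below : ∀ x → x < n → get encoding x ≡ true
  get-encoding-below x x<n rewrite encoding-≡ = get-ones-below n x x<n

  get-encoding-order : get encoding n ≡ false
  get-encoding-order rewrite encoding-≡ =
    trans (cong (get (List.replicate n true ++ _)) (sym (+-identityʳ n))) (get-ones-beyond n 0)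

  get-encoding-rows : ∀ y → get encoding (n + 1 + y) ≡ get (rows (adj G) ++ ys) y
  get-encoding-rows y rewrite encoding-≡ | +-assoc n 1 y = get-ones-beyond n (suc y)

  get-encoding-adj : ∀ u v → get encoding (n + 1 + toℕ u * n + toℕ v) ≡ adj G u v
  get-encoding-adj u v rewrite +-assoc (n + 1) (toℕ u * n) (toℕ v) =
    trans (get-encoding-rows _) (get-rows (adj G) u v)

  get-encoding-beyond : ∀ y → get encoding (n + 1 + n * n + y) ≡ get ys y
  get-encoding-beyond y rewrite +-assoc (n + 1) (n * n) y =
    trans (get-encoding-rows _) (get-rows-beyond (adj G) y)

length-encodeGraph : ∀ G → length (encodeGraph G) ≡ order G + 1 + order G * order G
length-encodeGraph G = begin
  length (List.replicate n true ++ false ∷ rows (adj G))          ≡⟨ length-++ (List.replicate n true) ⟩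
  length (List.replicate n true) + suc (length (rows (adj G)))    ≡⟨ cong₂ _+_ (length-replicate n) (cong suc (length-rows (adj G))) ⟩
  n + suc (n * n)                                                 ≡⟨ sym (+-assoc n 1 (n * n)) ⟩
  n + 1 + n * n                                                   ∎
  where
  open ≡-Reasoning
  n = order G

-- The consistency algorithm

ℓ# c# n# m# k# p# q# p′# q′# v# h# v′# h′# u# y# z# : Name
ℓ#  = 0F
c#  = 1F
n#  = 2F
m#  = 3F
k#  = 4F
p#  = 5F
q#  = 6F
p′# = 7F
q′# = 8F
v#  = 9F
h#  = suc 9F
v′# = suc (suc 9F)
h′# = suc (suc (suc 9F))
u#  = suc (suc (suc (suc 9F)))
y#  = suc (suc (suc (suc (suc 9F))))
z#  = suc (suc (suc (suc (suc (suc 9F)))))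

powᵉ : Name → ℕ → Exp
powᵉ b zero    = lit 1
powᵉ b (suc k) = var b *ᵉ powᵉ b k

pow-value : ∀ b k {M γ} → ⟦ powᵉ b k ⟧ M γ ≡ γ b ^ k
pow-value b zero            = refl
pow-value b (suc k) {M} {γ} = cong (γ b *_) (pow-value b k {M} {γ})

-- `letᵉ` evaluates the dividend before `z#` and `y#` are rebound, so the dividend may contain
-- quotients itself, as in `digitᵉ`.
quoᵉ remᵉ : Exp → Name → Exp
quoᵉ a b = letᵉ z# a (sumᵉ y# (var z#) ⌜ (var y# +ᵉ lit 1) *ᵉ var b ≤ᶠ var z# ⌝)
remᵉ a b = letᵉ z# a (var z# ∸ᵉ quoᵉ (var z#) b *ᵉ var b)

digitᵉ : Name → ℕ → Exp → Exp
digitᵉ b zero    e = remᵉ e b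
digitᵉ b (suc a) e = digitᵉ b a (quoᵉ e b)

-- A base named `z#` would be captured. For the two bases of digits in use, the updates of `z#` and
-- `y#` compute away.
digit-value-n : ∀ a e {M γ} → ⟦ digitᵉ n# a e ⟧ M γ ≡ digit (γ n#) a (⟦ e ⟧ M γ)
digit-value-n zero    e = refl
digit-value-n (suc a) e = digit-value-n a (quoᵉ e n#)

digit-value-m : ∀ a e {M γ} → ⟦ digitᵉ m# a e ⟧ M γ ≡ digit (γ m#) a (⟦ e ⟧ M γ)
digit-value-m zero    e = refl
digit-value-m (suc a) e = digit-value-m a (quoᵉ e m#)

startHᵉ : Exp
startHᵉ = var n# +ᵉ lit 1 +ᵉ var n# *ᵉ var n#

posGᵉ posHᵉ : Name → Name → Exp
posGᵉ u v = var n# +ᵉ lit 1 +ᵉ var u *ᵉ var n# +ᵉ var v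
posHᵉ u v = startHᵉ +ᵉ (var m# +ᵉ lit 1 +ᵉ var u *ᵉ var m# +ᵉ var v)

-- The sizes of the graphs are read off the unary prefixes of their codes.
nᵉ mᵉ : Exp
nᵉ = sumᵉ u# (var ℓ#) ⌜ ∀ᶠ y# (var u# +ᵉ lit 1) (bitᶠ (var y#)) ⌝
mᵉ = sumᵉ u# (var ℓ#) ⌜ ∀ᶠ y# (var u# +ᵉ lit 1) (bitᶠ (startHᵉ +ᵉ var y#)) ⌝

degGᵉ degHᵉ : Name → Exp
degGᵉ v = sumᵉ y# (var n#) (bit (posGᵉ v y#))
degHᵉ h = sumᵉ y# (var m#) (bit (posHᵉ h y#))

degreeF : Bool → Fm
degreeF true  = degGᵉ v# ≡ᶠ degHᵉ h#
degreeF false = lit 0 ≤ᶠ lit 0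

relF : Bool → Fm
relF β =
  (var v# ≡ᶠ var v′# ⇒ᶠ var h# ≡ᶠ var h′#) ∧ᶠ
  (bitᶠ (posGᵉ v# v′#) ⇒ᶠ bitᶠ (posHᵉ h# h′#)) ∧ᶠ
  ∀ᶠ u# (var n#) (bitᶠ (posGᵉ u# v#) ⇒ᶠ bitᶠ (posGᵉ u# v′#) ⇒ᶠ var h# ≡ᶠ var h′# ⇒ᶠ var v# ≡ᶠ var v′#) ∧ᶠ
  degreeF β

posG : ℕ → ℕ → ℕ → ℕ
posG n u v = n + 1 + u * n + v

posH : ℕ → ℕ → ℕ → ℕ → ℕ
posH n m u v = n + 1 + n * n + posG m u v

degG : List Bool → ℕ → ℕ → ℕ
degG M n v = Σ< n (λ y → b2n (get M (posG n v y)))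

degH : List Bool → ℕ → ℕ → ℕ → ℕ
degH M n m h = Σ< m (λ y → b2n (get M (posH n m h y)))

DegreeOK : Bool → List Bool → ℕ → ℕ → ℕ → ℕ → Set
DegreeOK true  M n m v h = degG M n v ≡ degH M n m h
DegreeOK false M n m v h = 0 ≤ 0

-- The binary constraint on the assignments v ↦ h and v′ ↦ h′; local
-- injectivity at u is the third clause, and the degree condition makes a
-- locally injective homomorphism locally bijective.
Rel : Bool → List Bool → (n m v h v′ h′ : ℕ) → Set
Rel β M n m v h v′ h′ =
  (v ≡ v′ → h ≡ h′) ×
  (T (get M (posG n v v′)) → T (get M (posH n m h h′))) ×
  (∀ u → u < n → T (get M (posG n u v)) → T (get M (posG n u v′)) → h ≡ h′ → v ≡ v′) ×
  DegreeOK β M n m v h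

relF-holds : ∀ β M γ → Holds (relF β) M γ ≡ Rel β M (γ n#) (γ m#) (γ v#) (γ h#) (γ v′#) (γ h′#)
relF-holds true  M γ = refl
relF-holds false M γ = refl

get-past : ∀ xs i → length xs ≤ i → get xs i ≡ true
get-past []       i       _       = refl
get-past (x ∷ xs) (suc i) (s≤s h) = get-past xs i h

T-ext : ∀ {a b} → (T a → T b) → (T b → T a) → a ≡ b
T-ext {false} {false} f g = refl
T-ext {false} {true}  f g = ⊥-elim (g tt)
T-ext {true}  {false} f g = ⊥-elim (f tt)
T-ext {true}  {true}  f g = refl

module _ (β : Bool) (κ d : ℕ) where

  -- The memory is the input followed by a table with a bit for each pair of a
  -- p < n ^ κ, coding κ vertices of G by its digits in base n, and a q < m ^ κ,
  -- coding their images in H by its digits in base m.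
  compatF bodyF cellF verdictF : Fm
  compatF = ⋀ᶠ κ λ a → ⋀ᶠ κ λ b →
    letᶠ v# (digitᵉ n# a (var p#)) (letᶠ h# (digitᵉ m# a (var q#))
    (letᶠ v′# (digitᵉ n# b (var p′#)) (letᶠ h′# (digitᵉ m# b (var q′#)) (relF β))))
  bodyF = ∀ᶠ p′# (powᵉ n# κ) (∃ᶠ q′# (var k#)
    (bitᶠ (var ℓ# +ᵉ (var p′# *ᵉ var k# +ᵉ var q′#)) ∧ᶠ compatF))

  sized : Fm → Fm
  sized f = letᶠ n# nᵉ (letᶠ m# mᵉ (letᶠ k# (powᵉ m# κ) f))

  -- Positions below `ℓ` copy the input, so the graphs stay readable in every round. A table bit is
  -- recomputed from its support alone, without its old value; that deleted entries never return is
  -- `alive-antitone`.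
  cellBodyF verdictBodyF : Fm
  cellBodyF =
    (lit 1 +ᵉ var c# ≤ᶠ var ℓ# ⇒ᶠ bitᶠ (var c#)) ∧ᶠ
    (var ℓ# ≤ᶠ var c# ⇒ᶠ
      letᶠ p# (quoᵉ (var c# ∸ᵉ var ℓ#) k#) (letᶠ q# (remᵉ (var c# ∸ᵉ var ℓ#) k#) bodyF))
  verdictBodyF =
    ∀ᶠ v# (var n#) (degGᵉ v# ≤ᶠ lit d) ∧ᶠ
    ∀ᶠ p# (powᵉ n# κ) (∃ᶠ q# (var k#) (bitᶠ (var ℓ# +ᵉ (var p# *ᵉ var k# +ᵉ var q#))))

  cellF    = sized cellBodyF
  verdictF = sized verdictBodyF

  -- Also the number of rounds: it exceeds the number of table entries, since `ℓ` is positive, and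
  -- so the table is stable at the end.
  cellsᵉ : Exp
  cellsᵉ = letᵉ n# nᵉ (letᵉ m# mᵉ (var ℓ# +ᵉ powᵉ n# κ *ᵉ powᵉ m# κ))

  consistency : Scheme
  consistency = record { cells = cellsᵉ ; rounds = cellsᵉ ; cell = ⌜ cellF ⌝ ; verdict = ⌜ verdictF ⌝ }

  module Instance (G H : Graph) where
    n = order G
    m = order H
    w = encodePair (G , H)
    ℓ = length w

    ℓ-≡ : ℓ ≡ n + 1 + n * n + (m + 1 + m * m)
    ℓ-≡ = trans (length-++ (encodeGraph G)) (cong₂ _+_ (length-encodeGraph G) (length-encodeGraph H))

    w-H : ∀ y → get w (n + 1 + n * n + y) ≡ get (encodeGraph H ++ []) y
    w-H y rewrite ++-identityʳ (encodeGraph H) = get-encoding-beyond G y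

    posG-< : ∀ {u v} → u < n → v < n → posG n u v < ℓ
    posG-< {u} {v} u<n v<n = begin-strict
      n + 1 + u * n + v                   ≡⟨ +-assoc (n + 1) (u * n) v ⟩
      n + 1 + (u * n + v)                 <⟨ +-monoʳ-< (n + 1) (*+-< u<n v<n) ⟩
      n + 1 + n * n                       ≤⟨ m≤m+n _ _ ⟩
      n + 1 + n * n + (m + 1 + m * m)     ≡⟨ sym ℓ-≡ ⟩
      ℓ                                   ∎
      where open ≤-Reasoning

    posH-< : ∀ {u v} → u < m → v < m → posH n m u v < ℓ
    posH-< {u} {v} u<m v<m = begin-strict
      n + 1 + n * n + (m + 1 + u * m + v)    ≡⟨ cong (n + 1 + n * n +_) (+-assoc (m + 1) (u * m) v) ⟩
      n + 1 + n * n + (m + 1 + (u * m + v))  <⟨ +-monoʳ-< (n + 1 + n * n) (+-monoʳ-< (m + 1) (*+-< u<m v<m)) ⟩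
      n + 1 + n * n + (m + 1 + m * m)        ≡⟨ sym ℓ-≡ ⟩
      ℓ                                      ∎
      where open ≤-Reasoning

    n<ℓ : n < ℓ
    n<ℓ = begin-strict
      n                                   <⟨ n<1+n n ⟩
      1 + n                               ≡⟨ +-comm 1 n ⟩
      n + 1                               ≤⟨ m≤m+n _ _ ⟩
      n + 1 + n * n                       ≤⟨ m≤m+n _ _ ⟩
      n + 1 + n * n + (m + 1 + m * m)     ≡⟨ sym ℓ-≡ ⟩
      ℓ                                   ∎
      where open ≤-Reasoning

    startH+m<ℓ : n + 1 + n * n + m < ℓ
    startH+m<ℓ = begin-strict
      n + 1 + n * n + m                   <⟨ +-monoʳ-< (n + 1 + n * n) (m<m+n m (s≤s z≤n)) ⟩
      n + 1 + n * n + (m + 1)             ≤⟨ +-monoʳ-≤ (n + 1 + n * n) (m≤m+n (m + 1) (m * m)) ⟩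
      n + 1 + n * n + (m + 1 + m * m)     ≡⟨ sym ℓ-≡ ⟩
      ℓ                                   ∎
      where open ≤-Reasoning

    Agree : List Bool → List Bool → Set
    Agree M M′ = ∀ i → i < ℓ → get M i ≡ get M′ i

    Rel-agree : ∀ {M M′ v h v′ h′} → Agree M M′ → v < n → h < m → v′ < n → h′ < m →
                Rel β M n m v h v′ h′ → Rel β M′ n m v h v′ h′
    Rel-agree {M} {M′} {v} {h} {v′} {h′} ag v<n h<m v′<n h′<m (r₁ , r₂ , r₃ , r₄) =
      r₁ ,
      (λ e → subst T (ag _ (posH-< h<m h′<m)) (r₂ (subst T (sym (ag _ (posG-< v<n v′<n))) e))) ,
      (λ u u<n e e′ → r₃ u u<n (subst T (sym (ag _ (posG-< u<n v<n))) e) (subst T (sym (ag _ (posG-< u<n v′<n))) e′)) ,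
      degree β r₄
      where
      degree : ∀ β → DegreeOK β M n m v h → DegreeOK β M′ n m v h
      degree true  eq = trans (Σ<-cong n (λ y y<n → cong b2n (sym (ag _ (posG-< v<n y<n)))))
        (trans eq (Σ<-cong m (λ y y<m → cong b2n (ag _ (posH-< h<m y<m)))))
      degree false eq = eq

    module _ {M : List Bool} (ag : Agree M w) where

      n-value : ∀ {γ} → γ ℓ# ≡ ℓ → ⟦ nᵉ ⟧ M γ ≡ n
      n-value {γ} eq = trans (cong (λ N → Σ< N f) eq) (Σ<-threshold ℓ n f (<⇒≤ n<ℓ)
        (λ x x<ℓ x<n → 1∸-decides-yes (Σ< (x + 1) (λ y → 1 ∸ b2n (get M y))) (dec x) (λ y y<1+x →
          subst T (sym (trans (ag y (below x y x<ℓ y<1+x)) (get-encoding-below G y (below x y x<n y<1+x)))) tt))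
        (λ x x<ℓ n≤x → decides-no (f x) (dec x) (λ all →
          subst T (trans (ag n n<ℓ) (get-encoding-order G)) (all n (≤-trans (s≤s n≤x) (≤-reflexive (+-comm 1 x)))))))
        where
        f : ℕ → ℕ
        f x = ⟦ ⌜ ∀ᶠ y# (var u# +ᵉ lit 1) (bitᶠ (var y#)) ⌝ ⟧ M (γ [ u# ≔ x ])
        dec : ∀ x → f x decides (∀ y → y < x + 1 → T (get M y))
        dec x = ⌜⌝-decides (∀ᶠ y# (var u# +ᵉ lit 1) (bitᶠ (var y#))) M (γ [ u# ≔ x ])
        below : ∀ x y {k} → x < k → y < x + 1 → y < k
        below x y x<k y<x+1 = ≤-trans (subst (y <_) (+-comm x 1) y<x+1) x<k

      m-value : ∀ {γ} → γ ℓ# ≡ ℓ → γ n# ≡ n → ⟦ mᵉ ⟧ M γ ≡ m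
      m-value {γ} eq eqₙ = trans (cong (λ N → Σ< N f) eq) (Σ<-threshold ℓ m f
        (≤-trans (m≤n+m m _) (<⇒≤ startH+m<ℓ))
        (λ x _ x<m → 1∸-decides-yes (Σ< (x + 1) (λ y → 1 ∸ b2n (get M (γ n# + 1 + γ n# * γ n# + y)))) (dec x) (λ y y<1+x →
          subst T (sym (bit-y y (<⇒≤ (below x y x<m y<1+x)) (get-encoding-below H y (below x y x<m y<1+x)))) tt))
        (λ x x<ℓ m≤x → decides-no (f x) (dec x) (λ all →
          subst T (bit-y m ≤-refl (get-encoding-order H)) (all m (≤-trans (s≤s m≤x) (≤-reflexive (+-comm 1 x)))))))
        where
        f : ℕ → ℕ
        f x = ⟦ ⌜ ∀ᶠ y# (var u# +ᵉ lit 1) (bitᶠ (startHᵉ +ᵉ var y#)) ⌝ ⟧ M (γ [ u# ≔ x ])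
        dec : ∀ x → f x decides (∀ y → y < x + 1 → T (get M (γ n# + 1 + γ n# * γ n# + y)))
        dec x = ⌜⌝-decides (∀ᶠ y# (var u# +ᵉ lit 1) (bitᶠ (startHᵉ +ᵉ var y#))) M (γ [ u# ≔ x ])
        below : ∀ x y {k} → x < k → y < x + 1 → y < k
        below x y x<k y<x+1 = ≤-trans (subst (y <_) (+-comm x 1) y<x+1) x<k
        bit-y : ∀ y {b} → y ≤ m → get (encodeGraph H ++ []) y ≡ b → get M (γ n# + 1 + γ n# * γ n# + y) ≡ b
        bit-y y y≤m e rewrite eqₙ =
          trans (ag _ (≤-trans (s≤s (+-monoʳ-≤ (n + 1 + n * n) y≤m)) startH+m<ℓ)) (trans (w-H y) e)

-- Meaning of one round of deletion

T-reflects : ∀ {P : Set} {b} → Reflects P b → T b → P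
T-reflects (ofʸ p) _ = p

reflects-T : ∀ {P : Set} {b} → Reflects P b → P → T b
reflects-T (ofʸ _)  _ = tt
reflects-T (ofⁿ ¬p) p = ¬p p

reflects-⇔ : ∀ {P Q : Set} {b} → (P → Q) → (Q → P) → Reflects P b → Reflects Q b
reflects-⇔ f g (ofʸ p)  = ofʸ (f p)
reflects-⇔ f g (ofⁿ ¬p) = ofⁿ (¬p ∘ g)

-- A positive power of 0 is 0, so over an empty set there is no tuple with a position `a`. This
-- keeps digits in range even for graphs without vertices.
base>0 : ∀ {p b k a} → p < b ^ k → a < k → 0 < b
base>0 {b = zero}  {suc k} () _
base>0 {b = suc b}         _  _ = s≤s z≤n

module Consistency (β : Bool) (κ d : ℕ) (G H : Graph) where
  open Instance β κ d G H

  𝒮 : Scheme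
  𝒮 = consistency β κ d

  Compat : List Bool → (p q p′ q′ : ℕ) → Set
  Compat M p q p′ q′ = ∀ a → a < κ → ∀ b → b < κ →
    Rel β M n m (digit n a p) (digit m a q) (digit n b p′) (digit m b q′)

  Compat-agree : ∀ {M M′ p q p′ q′} → Agree M M′ → p < n ^ κ → q < m ^ κ →
                 Compat M p q p′ q′ → Compat M′ p q p′ q′
  Compat-agree {M} {M′} {p} {q} {p′} {q′} ag p< q< h a a<κ b b<κ = Rel-agree {M} {M′} ag
    (digit-< a p (base>0 p< a<κ)) (digit-< a q (base>0 q< a<κ))
    (digit-< b p′ (base>0 p< a<κ)) (digit-< b q′ (base>0 q< a<κ))
    (h a a<κ b b<κ)

  entry : ℕ → ℕ → ℕ
  entry p q = p * m ^ κ + q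

  -- Only the surviving entries are read from `M`; compatibility refers to the input `w`, so it is
  -- the same relation in every round, as in `Fixpoint`.
  Supported : List Bool → ℕ → ℕ → Set
  Supported M p q = ∀ p′ → p′ < n ^ κ →
    ∃[ q′ ] (q′ < m ^ κ × T (get M (ℓ + entry p′ q′)) × Compat w p q p′ q′)

  Rel-cong : ∀ {M v₁ v₂ h₁ h₂ v′₁ v′₂ h′₁ h′₂} → v₁ ≡ v₂ → h₁ ≡ h₂ → v′₁ ≡ v′₂ → h′₁ ≡ h′₂ →
             Rel β M n m v₁ h₁ v′₁ h′₁ ≡ Rel β M n m v₂ h₂ v′₂ h′₂
  Rel-cong refl refl refl refl = refl

  base : ℕ → Env
  base i = γ₀ ℓ [ c# ≔ i ] [ n# ≔ n ] [ m# ≔ m ] [ k# ≔ m ^ κ ]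

  module _ {M : List Bool} (ag : Agree M w) where

    sized-holds : ∀ f {γ} → γ ℓ# ≡ ℓ →
      Holds (sized β κ d f) M γ ≡ Holds f M (γ [ n# ≔ n ] [ m# ≔ m ] [ k# ≔ m ^ κ ])
    sized-holds f {γ} eq =
      trans (cong (λ a → F a m₁ k₁) n-eq) (trans (cong (λ b → F n b k₁) m-eq) (cong (F n m) k-eq))
      where
      F : ℕ → ℕ → ℕ → Set
      F a b c = Holds f M (γ [ n# ≔ a ] [ m# ≔ b ] [ k# ≔ c ])
      n₁ = ⟦ nᵉ ⟧ M γ
      m₁ = ⟦ mᵉ ⟧ M (γ [ n# ≔ n₁ ])
      k₁ = ⟦ powᵉ m# κ ⟧ M (γ [ n# ≔ n₁ ] [ m# ≔ m₁ ])
      n-eq : n₁ ≡ n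
      n-eq = n-value {M} ag {γ} eq
      m-eq : m₁ ≡ m
      m-eq = m-value {M} ag {γ [ n# ≔ n₁ ]} eq n-eq
      k-eq : k₁ ≡ m ^ κ
      k-eq = trans (pow-value m# κ {M} {γ [ n# ≔ n₁ ] [ m# ≔ m₁ ]}) (cong (_^ κ) m-eq)

    cells-value : ∀ {γ} → γ ℓ# ≡ ℓ → ⟦ cellsᵉ β κ d ⟧ M γ ≡ ℓ + n ^ κ * m ^ κ
    cells-value {γ} eq = cong₂ _+_ eq (cong₂ _*_
      (trans (pow-value n# κ {M} {γ [ n# ≔ n₁ ] [ m# ≔ m₁ ]}) (cong (_^ κ) n-eq))
      (trans (pow-value m# κ {M} {γ [ n# ≔ n₁ ] [ m# ≔ m₁ ]}) (cong (_^ κ) (m-value {M} ag {γ [ n# ≔ n₁ ]} eq n-eq))))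
      where
      n₁ = ⟦ nᵉ ⟧ M γ
      m₁ = ⟦ mᵉ ⟧ M (γ [ n# ≔ n₁ ])
      n-eq : n₁ ≡ n
      n-eq = n-value {M} ag {γ} eq

    get-next : ∀ i → i < ℓ + n ^ κ * m ^ κ → get (next 𝒮 ℓ M) i ≡ cellAt 𝒮 ℓ M i
    get-next i i< = get-fill (cellAt 𝒮 ℓ M) (⟦ cellsᵉ β κ d ⟧ M (γ₀ ℓ)) [] i
      (subst (i <_) (sym (cells-value {γ₀ ℓ} refl)) i<)

    compat-holds : ∀ {i p q p′ q′} a b →
      Holds (letᶠ v# (digitᵉ n# a (var p#)) (letᶠ h# (digitᵉ m# a (var q#))
        (letᶠ v′# (digitᵉ n# b (var p′#)) (letᶠ h′# (digitᵉ m# b (var q′#)) (relF β))))) M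
        (base i [ p# ≔ p ] [ q# ≔ q ] [ p′# ≔ p′ ] [ q′# ≔ q′ ])
      ≡ Rel β M n m (digit n a p) (digit m a q) (digit n b p′) (digit m b q′)
    compat-holds {i} {p} {q} {p′} {q′} a b = trans (relF-holds β M γ₄) (Rel-cong
      (digit-value-n a (var p#) {M} {γ}) (digit-value-m a (var q#) {M} {γ₁})
      (digit-value-n b (var p′#) {M} {γ₂}) (digit-value-m b (var q′#) {M} {γ₃}))
      where
      γ γ₁ γ₂ γ₃ γ₄ : Env
      γ  = base i [ p# ≔ p ] [ q# ≔ q ] [ p′# ≔ p′ ] [ q′# ≔ q′ ]
      γ₁ = γ [ v# ≔ ⟦ digitᵉ n# a (var p#) ⟧ M γ ]
      γ₂ = γ₁ [ h# ≔ ⟦ digitᵉ m# a (var q#) ⟧ M γ₁ ]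
      γ₃ = γ₂ [ v′# ≔ ⟦ digitᵉ n# b (var p′#) ⟧ M γ₂ ]
      γ₄ = γ₃ [ h′# ≔ ⟦ digitᵉ m# b (var q′#) ⟧ M γ₃ ]

    module _ {i p q : ℕ} (p< : p < n ^ κ) (q< : q < m ^ κ) where
      private
        γ : Env
        γ = base i [ p# ≔ p ] [ q# ≔ q ]
        n^κ-≡ : ⟦ powᵉ n# κ ⟧ M γ ≡ n ^ κ
        n^κ-≡ = pow-value n# κ {M} {γ}

      body-supported : Holds (bodyF β κ d) M γ → Supported M p q
      body-supported h p′ p′< with h p′ (subst (p′ <_) (sym n^κ-≡) p′<)
      ... | q′ , q′< , alive , compat = q′ , q′< , alive ,
        Compat-agree {M} {w} {p′ = p′} {q′} ag p< q< (λ a a<κ b b<κ → subst id (compat-holds {i} {p} {q} {p′} {q′} a b) (compat a a<κ b b<κ))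

      supported-body : Supported M p q → Holds (bodyF β κ d) M γ
      supported-body h p′ p′< with h p′ (subst (p′ <_) n^κ-≡ p′<)
      ... | q′ , q′< , alive , compat = q′ , q′< , alive , λ a a<κ b b<κ →
        subst id (sym (compat-holds {i} {p} {q} {p′} {q′} a b))
          (Compat-agree {w} {M} {p′ = p′} {q′} (λ j j<ℓ → sym (ag j j<ℓ)) p< q< compat a a<κ b b<κ)

    CellHolds : ℕ → Set
    CellHolds i = (suc i ≤ ℓ → T (get M i)) ×
      (ℓ ≤ i → Holds (bodyF β κ d) M (base i [ p# ≔ quo (i ∸ ℓ) (m ^ κ) ] [ q# ≔ rem (i ∸ ℓ) (m ^ κ) ]))

    next-reflects : ∀ i → i < ℓ + n ^ κ * m ^ κ → Reflects (CellHolds i) (get (next 𝒮 ℓ M) i)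
    next-reflects i i< = subst (Reflects (CellHolds i)) (sym (get-next i i<))
      (subst (λ P → Reflects P (cellAt 𝒮 ℓ M i)) (sized-holds (cellBodyF β κ d) {γ₀ ℓ [ c# ≔ i ]} refl)
        (⌜⌝-decides (cellF β κ d) M (γ₀ ℓ [ c# ≔ i ])))

    next-agrees : Agree (next 𝒮 ℓ M) w
    next-agrees i i<ℓ = trans (T-ext
      (λ t → proj₁ (T-reflects (next-reflects i i<) t) i<ℓ)
      (λ t → reflects-T (next-reflects i i<) ((λ _ → t) , λ ℓ≤i → ⊥-elim (<⇒≱ i<ℓ ℓ≤i))))
      (ag i i<ℓ)
      where
      i< : i < ℓ + n ^ κ * m ^ κ
      i< = ≤-trans i<ℓ (m≤m+n ℓ _)

    module _ {p q : ℕ} (p< : p < n ^ κ) (q< : q < m ^ κ) where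
      private
        i = ℓ + entry p q
        i< : i < ℓ + n ^ κ * m ^ κ
        i< = +-monoʳ-< ℓ (*+-< p< q<)
        p-≡ : quo (i ∸ ℓ) (m ^ κ) ≡ p
        p-≡ = trans (cong (λ x → quo x (m ^ κ)) (m+n∸m≡n ℓ (entry p q))) (quo-≡ p q<)
        q-≡ : rem (i ∸ ℓ) (m ^ κ) ≡ q
        q-≡ = trans (cong (λ x → rem x (m ^ κ)) (m+n∸m≡n ℓ (entry p q))) (rem-≡ p q<)

      next-supported : T (get (next 𝒮 ℓ M) i) → Supported M p q
      next-supported t = body-supported p< q< (subst₂ (λ x y → Holds (bodyF β κ d) M (base i [ p# ≔ x ] [ q# ≔ y ]))
        p-≡ q-≡ (proj₂ (T-reflects (next-reflects i i<) t) (m≤m+n ℓ _)))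

      supported-next : Supported M p q → T (get (next 𝒮 ℓ M) i)
      supported-next h = reflects-T (next-reflects i i<)
        ((λ i<ℓ → ⊥-elim (<⇒≱ i<ℓ (m≤m+n ℓ _))) ,
         λ _ → subst₂ (λ x y → Holds (bodyF β κ d) M (base i [ p# ≔ x ] [ q# ≔ y ])) (sym p-≡) (sym q-≡)
           (supported-body {i} p< q< h))

  memory : ℕ → List Bool
  memory r = iterateNext 𝒮 ℓ r w

  memory-agrees : ∀ r → Agree (memory r) w
  memory-agrees zero    i _ = refl
  memory-agrees (suc r) = next-agrees (memory-agrees r)

  Alive : ℕ → ℕ → ℕ → Set
  Alive r p q = T (get (memory r) (ℓ + entry p q))

  alive₀ : ∀ p q → Alive 0 p q
  alive₀ p q = subst T (sym (get-past w (ℓ + entry p q) (m≤m+n ℓ _))) tt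

  R : ℕ
  R = ℓ + n ^ κ * m ^ κ

  result-reflects : Reflects
    ((∀ v → v < n → degG w n v ≤ d) × (∀ p → p < n ^ κ → ∃[ q ] (q < m ^ κ × Alive R p q)))
    (result 𝒮 w)
  result-reflects = subst (λ r → Reflects Verdict (nonzero (⟦ ⌜ verdictF β κ d ⌝ ⟧ (memory r) (γ₀ ℓ))))
    (sym (cells-value {w} (λ _ _ → refl) {γ₀ ℓ} refl))
    (reflects-⇔ to from
      (subst (λ P → Reflects P (nonzero (⟦ ⌜ verdictF β κ d ⌝ ⟧ (memory R) (γ₀ ℓ))))
        (sized-holds {memory R} (memory-agrees R) (verdictBodyF β κ d) {γ₀ ℓ} refl) (⌜⌝-decides (verdictF β κ d) (memory R) (γ₀ ℓ))))
    where
    Verdict : Set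
    Verdict = (∀ v → v < n → degG w n v ≤ d) × (∀ p → p < n ^ κ → ∃[ q ] (q < m ^ κ × Alive R p q))
    γ : Env
    γ = γ₀ ℓ [ n# ≔ n ] [ m# ≔ m ] [ k# ≔ m ^ κ ]
    n^κ-≡ : ⟦ powᵉ n# κ ⟧ (memory R) γ ≡ n ^ κ
    n^κ-≡ = pow-value n# κ {memory R} {γ}
    degG-≡ : ∀ v → v < n → degG (memory R) n v ≡ degG w n v
    degG-≡ v v<n = Σ<-cong n (λ y y<n → cong b2n (memory-agrees R _ (posG-< v<n y<n)))
    to : (∀ v → v < n → degG (memory R) n v ≤ d) ×
         (∀ p → p < ⟦ powᵉ n# κ ⟧ (memory R) γ → ∃[ q ] (q < m ^ κ × Alive R p q)) → Verdict
    to (deg , all) = (λ v v<n → subst (_≤ d) (degG-≡ v v<n) (deg v v<n)) ,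
      λ p p< → all p (subst (p <_) (sym n^κ-≡) p<)
    from : Verdict → (∀ v → v < n → degG (memory R) n v ≤ d) ×
         (∀ p → p < ⟦ powᵉ n# κ ⟧ (memory R) γ → ∃[ q ] (q < m ^ κ × Alive R p q))
    from (deg , all) = (λ v v<n → subst (_≤ d) (sym (degG-≡ v v<n)) (deg v v<n)) ,
      λ p p< → all p (subst (p <_) n^κ-≡ p<)

-- Fixpoints

Σ<-mono : ∀ n {f g : ℕ → ℕ} → (∀ v → v < n → f v ≤ g v) → Σ< n f ≤ Σ< n g
Σ<-mono zero    h = z≤n
Σ<-mono (suc n) h = +-mono-≤ (h n ≤-refl) (Σ<-mono n (λ v v<n → h v (m≤n⇒m≤1+n v<n)))

-- Turns an unchanged count into an unchanged table: a drop in one term could not be made up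
-- elsewhere. It is applied to the rows first and then to the entries of a row.
Σ<-tight : ∀ n {f g : ℕ → ℕ} → (∀ v → v < n → f v ≤ g v) → Σ< n g ≤ Σ< n f →
           ∀ v → v < n → g v ≤ f v
Σ<-tight (suc n) {f} {g} h g≤f v v<1+n with m≤n⇒m<n∨m≡n (≤-pred v<1+n)
... | inj₂ refl = +-cancelʳ-≤ (Σ< v f) (g v) (f v)
  (≤-trans (+-monoʳ-≤ (g v) (Σ<-mono v (λ u u<v → h u (m≤n⇒m≤1+n u<v)))) g≤f)
... | inj₁ v<n = Σ<-tight n (λ u u<n → h u (m≤n⇒m≤1+n u<n))
  (+-cancelˡ-≤ (g n) (Σ< n g) (Σ< n f) (≤-trans g≤f (+-monoˡ-≤ (Σ< n f) (h n ≤-refl)))) v v<n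

b2n-mono : ∀ {a b} → (T a → T b) → b2n a ≤ b2n b
b2n-mono {false}        h = z≤n
b2n-mono {true} {true}  h = ≤-refl
b2n-mono {true} {false} h = ⊥-elim (h tt)

b2n-reflect : ∀ {a b} → b2n a ≤ b2n b → T a → T b
b2n-reflect {true} {true} _ _ = tt

module Fixpoint {a b : ℕ} (alive : ℕ → ℕ → ℕ → Bool) (Compat : ℕ → ℕ → ℕ → ℕ → Set) where

  Supported : ℕ → ℕ → ℕ → Set
  Supported r p q = ∀ p′ → p′ < a → ∃[ q′ ] (q′ < b × T (alive r p′ q′) × Compat p q p′ q′)

  module _ (alive₀ : ∀ p q → T (alive 0 p q))
           (unfold : ∀ r {p q} → p < a → q < b → T (alive (suc r) p q) → Supported r p q)
           (fold : ∀ r {p q} → p < a → q < b → Supported r p q → T (alive (suc r) p q)) where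

    Supported-mono : ∀ r r′ {p q} →
      (∀ {p q} → p < a → q < b → T (alive r p q) → T (alive r′ p q)) →
      Supported r p q → Supported r′ p q
    Supported-mono r r′ h supp p′ p′< with supp p′ p′<
    ... | q′ , q′< , t , compat = q′ , q′< , h p′< q′< t , compat

    -- The first table is full and the operator is monotone, so the inclusion of the second table in
    -- the first propagates to all later rounds.
    alive-antitone : ∀ r {p q} → p < a → q < b → T (alive (suc r) p q) → T (alive r p q)
    alive-antitone zero    {p} {q} _ _ _ = alive₀ p q
    alive-antitone (suc r) p< q< t =
      fold r p< q< (Supported-mono (suc r) r (alive-antitone r) (unfold (suc r) p< q< t))

    Stable : ℕ → Set
    Stable r = ∀ {p q} → p < a → q < b → T (alive r p q) → T (alive (suc r) p q)

    stable-suc : ∀ r → Stable r → Stable (suc r)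
    stable-suc r st p< q< t =
      fold (suc r) p< q< (Supported-mono r (suc r) st (unfold r p< q< t))

    stable-≤ : ∀ {r r′} → r ≤′ r′ → Stable r → Stable r′
    stable-≤ (≤′-reflexive refl)      st = st
    stable-≤ (≤′-step {n = r′} r≤r′) st = stable-suc r′ (stable-≤ r≤r′ st)

    rowCount : ℕ → ℕ → ℕ
    rowCount r p = Σ< b (λ q → b2n (alive r p q))

    count : ℕ → ℕ
    count r = Σ< a (rowCount r)

    rowCount-antitone : ∀ r p → p < a → rowCount (suc r) p ≤ rowCount r p
    rowCount-antitone r p p< = Σ<-mono b (λ q q< → b2n-mono (alive-antitone r p< q<))

    stable-or-smaller : ∀ r → count (suc r) < count r ⊎ Stable r
    stable-or-smaller r with count (suc r) <? count r
    ... | yes fewer = inj₁ fewer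
    ... | no ¬fewer = inj₂ λ {p} {q} p< q< → b2n-reflect
      (Σ<-tight b (λ q q< → b2n-mono (alive-antitone r p< q<))
        (Σ<-tight a (rowCount-antitone r) (≮⇒≥ ¬fewer) p p<) q q<)

    -- Potential argument: each round that is not stable deletes at least one of the `a * b`
    -- entries.
    few-or-stable : ∀ r → count r + r ≤ a * b ⊎ Σ[ r′ ∈ ℕ ] (r′ < r × Stable r′)
    few-or-stable zero = inj₁ (≤-trans (≤-reflexive (+-identityʳ _))
      (Σ<-≤ a (λ p _ → ≤-trans (Σ<-≤ b (λ q _ → b2n≤1 _)) (≤-reflexive (*-identityʳ _)))))
    few-or-stable (suc r) with few-or-stable r
    ... | inj₂ (r′ , r′<r , st) = inj₂ (r′ , m≤n⇒m≤1+n r′<r , st)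
    ... | inj₁ few with stable-or-smaller r
    ...   | inj₂ st   = inj₂ (r , ≤-refl , st)
    ...   | inj₁ fewer = inj₁ (≤-trans (≤-reflexive (+-suc _ r)) (≤-trans (+-monoˡ-≤ r fewer) few))

    eventually-stable : ∀ {r} → a * b < r → Stable r
    eventually-stable {r} ab<r with few-or-stable r
    ... | inj₂ (r′ , r′<r , st) = stable-≤ (≤⇒≤′ (<⇒≤ r′<r)) st
    ... | inj₁ few = ⊥-elim (<⇒≱ ab<r (≤-trans (m≤n+m r (count r)) few))

    alive-supported : ∀ {r p q} → a * b < r → p < a → q < b → T (alive r p q) → Supported r p q
    alive-supported {r} ab<r p< q< t = unfold r p< q< (eventually-stable ab<r p< q< t)

    -- The entries cut out of one global solution support each other, so no round can delete the
    -- first of them.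
    always-alive : ∀ (image : ℕ → ℕ) → (∀ {p} → p < a → image p < b) →
      (∀ {p p′} → p < a → p′ < a → Compat p (image p) p′ (image p′)) →
      ∀ r {p} → p < a → T (alive r p (image p))
    always-alive image image< compat zero    {p} p< = alive₀ p (image p)
    always-alive image image< compat (suc r) {p} p< = fold r p< (image< p<) λ p′ p′< →
      image p′ , image< p′< , always-alive image image< compat r p′< , compat p< p′<

module Assignments (β : Bool) (κ d : ℕ) (G H : Graph) where
  open Instance β κ d G H
  open Consistency β κ d G H

  alive : ℕ → ℕ → ℕ → Bool
  alive r p q = get (memory r) (ℓ + entry p q)

  unfold : ∀ r {p q} → p < n ^ κ → q < m ^ κ → T (alive (suc r) p q) → Supported (memory r) p q
  unfold r {p} {q} p< q< = next-supported (memory-agrees r) {p} {q} p< q<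

  fold : ∀ r {p q} → p < n ^ κ → q < m ^ κ → Supported (memory r) p q → T (alive (suc r) p q)
  fold r {p} {q} p< q< = supported-next (memory-agrees r) {p} {q} p< q<

  alive-supported : ∀ {p q} → p < n ^ κ → q < m ^ κ → T (alive R p q) → Supported (memory R) p q
  alive-supported = Fixpoint.alive-supported {n ^ κ} {m ^ κ} alive (Compat w) alive₀ unfold fold
    (m<n+m (n ^ κ * m ^ κ) (≤-trans (s≤s z≤n) n<ℓ))

  module _ (Φ : ℕ → ℕ) (Φ< : ∀ v → v < n → Φ v < m)
           (solution : ∀ v v′ → v < n → v′ < n → Rel β w n m v (Φ v) v′ (Φ v′)) where

    image : ℕ → ℕ
    image p = code m κ (λ a → Φ (digit n a p))

    image-digits : ∀ {p} → p < n ^ κ → ∀ a → a < κ → Φ (digit n a p) < m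
    image-digits {p} p< a a<κ = Φ< _ (digit-< a p (base>0 p< a<κ))

    image-< : ∀ {p} → p < n ^ κ → image p < m ^ κ
    image-< p< = code-< κ _ (image-digits p<)

    image-digit : ∀ {p} → p < n ^ κ → ∀ a → a < κ → digit m a (image p) ≡ Φ (digit n a p)
    image-digit p< a a<κ = digit-code κ _ a a<κ (image-digits p<)

    image-compat : ∀ {p p′} → p < n ^ κ → p′ < n ^ κ → Compat w p (image p) p′ (image p′)
    image-compat {p} {p′} p< p′< a a<κ b b<κ =
      subst id (Rel-cong {w} refl (sym (image-digit p< a a<κ)) refl (sym (image-digit p′< b b<κ)))
        (solution _ _ (digit-< a p (base>0 p< a<κ)) (digit-< b p′ (base>0 p< a<κ)))

    image-alive : ∀ {p} → p < n ^ κ → T (alive R p (image p))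
    image-alive = Fixpoint.always-alive {n ^ κ} {m ^ κ} alive (Compat w) alive₀ unfold fold
      image image-< image-compat R

-- Labelling trees

lookup-unique : ∀ {A : Set} {xs : List A} → Unique xs → Injective _≡_ _≡_ (List.lookup xs)
lookup-unique {xs = x ∷ xs} (x≢ ∷ uniq) {zero}  {zero}  eq = refl
lookup-unique {xs = x ∷ xs} (x≢ ∷ uniq) {zero}  {suc j} eq = ⊥-elim (All.lookup x≢ (∈-lookup j) eq)
lookup-unique {xs = x ∷ xs} (x≢ ∷ uniq) {suc i} {zero}  eq = ⊥-elim (All.lookup x≢ (∈-lookup i) (sym eq))
lookup-unique {xs = x ∷ xs} (x≢ ∷ uniq) {suc i} {suc j} eq = cong suc (lookup-unique uniq eq)

module _ (G : Graph) where

  -- The list index leaves out the starting vertex.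
  data Path (P : Vertex G → Set) : Vertex G → List (Vertex G) → Vertex G → Set where
    stop : ∀ {u} → P u → Path P u [] u
    _∷_  : ∀ {u v vs w} → P u × Adj G u v → Path P v vs w → Path P u (v ∷ vs) w

  open DecMembership (Fin._≟_ {order G}) using () renaming (_∈?_ to _∈ᴸ?_)

  module _ {P : Vertex G → Set} where

    path-inside : ∀ {u vs w} → Path P u vs w → All P (u ∷ vs)
    path-inside (stop Pu)       = Pu ∷ []
    path-inside ((Pu , _) ∷ ps) = Pu ∷ path-inside ps

    path-step : ∀ {u vs w} → Path P u vs w → ∀ i →
                Adj G (List.lookup (u ∷ vs) (inject₁ i)) (List.lookup vs i)
    path-step ((_ , uv) ∷ ps) zero    = uv
    path-step (_ ∷ ps)        (suc i) = path-step ps i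

    path-end : ∀ {u vs w} → Path P u vs w → List.lookup (u ∷ vs) (fromℕ (length vs)) ≡ w
    path-end (stop _) = refl
    path-end (_ ∷ ps) = path-end ps

    SimplePath : Vertex G → Vertex G → Set
    SimplePath u w = ∃[ vs ] (Path P u vs w × Unique (u ∷ vs))

    from : ∀ {u v vs w} → u ∈ v ∷ vs → Path P v vs w → Unique (v ∷ vs) → SimplePath u w
    from (here refl) ps       uniq       = _ , ps , uniq
    from (there u∈)  (_ ∷ ps) (_ ∷ uniq) = from u∈ ps uniq

    -- Loop erasure: when the first vertex recurs on the rest of the path, everything before the
    -- recurrence is dropped.
    simplify : ∀ {u w} → P u → Star (λ x y → P x × Adj G x y × P y) u w → SimplePath u w
    simplify Pu ε = [] , stop Pu , [] ∷ []
    simplify {u} Pu ((_ , uv , Pv) ◅ walk) with simplify Pv walk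
    ... | vs , ps , uniq with u ∈ᴸ? (_ ∷ vs)
    ...   | yes u∈ = from u∈ ps uniq
    ...   | no u∉  = _ ∷ vs , (Pu , uv) ∷ ps , ¬Any⇒All¬ _ u∉ ∷ uniq

    -- `y` is off the path because it lacks `P`, and the path has a vertex besides `x` because its
    -- ends differ; this gives the three vertices that a `Cycle` requires.
    close-cycle : ∀ {x y z} → ¬ P y → x ≢ z → Adj G y x → Adj G z y → SimplePath x z → Cycle G
    close-cycle ¬Py x≢z yx zy ([] , stop _ , _) = ⊥-elim (x≢z refl)
    close-cycle {x} {y} {z} ¬Py x≢z yx zy (v ∷ vs , ps , uniq) = record
      { k        = length vs
      ; at       = List.lookup cycle
      ; distinct = lookup-unique (All.map (λ { Pv refl → ¬Py Pv }) (path-inside ps) ∷ uniq)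
      ; step     = λ { zero → yx ; (suc i) → path-step ps i }
      ; close    = subst (λ u → Adj G u y) (sym (path-end ps)) zy
      }
      where
      cycle : List (Vertex G)
      cycle = y ∷ x ∷ v ∷ vs

  crossing : ∀ (X : Subset (order G)) {u w} → u ∈ˢ X → w ∉ˢ X →
             Star (λ x y → ⊤ × Adj G x y × ⊤) u w →
             ∃[ x ] ∃[ y ] (x ∈ˢ X × y ∉ˢ X × Adj G x y)
  crossing X u∈X w∉X ε = ⊥-elim (w∉X u∈X)
  crossing X u∈X w∉X (_◅_ {j = v} (_ , uv , _) walk) with v ∈? X
  ... | yes v∈X = crossing X v∈X w∉X walk
  ... | no v∉X  = _ , v , u∈X , v∉X , uv

  adj-sym : ∀ {u v} → Adj G u v → Adj G v u
  adj-sym {u} {v} = subst T (symm G u v)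

  adj-irrefl : ∀ {u v} → u ≡ v → ¬ Adj G u v
  adj-irrefl {u} refl = subst T (noLoop G u)

-- In a tree a labelling is found greedily, growing a connected set X of
-- labelled vertices: a second neighbour of a new vertex in X would close a
-- cycle.
module Labelling {T : Graph} (isTree : IsTree T) {Q : Set}
  (Valid : Vertex T → Q → Set) (Link : Vertex T → Q → Vertex T → Q → Set)
  (extend : ∀ {i q} → Valid i q → ∀ j → ∃[ q′ ] (Valid j q′ × Link i q j q′)) where

  -- A link is obtained in the direction in which the labelling grows, and `Link` need not be
  -- symmetric, so either direction counts.
  Linked : (Vertex T → Q) → Vertex T → Vertex T → Set
  Linked label i j = Link i (label i) j (label j) ⊎ Link j (label j) i (label i)

  record Partial (X : Subset (order T)) : Set where
    field
      label  : Vertex T → Q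
      root   : Vertex T
      root∈  : root ∈ˢ X
      valid  : ∀ {i} → i ∈ˢ X → Valid i (label i)
      linked : ∀ {i j} → i ∈ˢ X → j ∈ˢ X → Adj T i j → Linked label i j
      joined : ConnectedOn T (_∈ˢ X)

  module _ {X : Subset (order T)} (S : Partial X) {x y} (x∈X : x ∈ˢ X) (y∉X : y ∉ˢ X) (xy : Adj T x y) where
    open Partial S

    only-neighbour : ∀ {z} → z ∈ˢ X → Adj T z y → x ≡ z
    only-neighbour {z} z∈X zy with x Fin.≟ z
    ... | yes x≡z = x≡z
    ... | no x≢z  = ⊥-elim (IsTree.acyclic isTree
      (close-cycle T y∉X x≢z (adj-sym T xy) zy (simplify T x∈X (joined x z x∈X z∈X))))

    private
      fresh = extend (valid x∈X) y

      label′ : Vertex T → Q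
      label′ i = if does (i Fin.≟ y) then proj₁ fresh else label i

      label′-y : label′ y ≡ proj₁ fresh
      label′-y with y Fin.≟ y
      ... | yes _  = refl
      ... | no y≢y = ⊥-elim (y≢y refl)

      label′-X : ∀ {i} → i ∈ˢ X → label′ i ≡ label i
      label′-X {i} i∈X with i Fin.≟ y
      ... | yes refl = ⊥-elim (y∉X i∈X)
      ... | no _     = refl

      X′ : Subset (order T)
      X′ = X ∪ ⁅ y ⁆

      cases : ∀ {i} → i ∈ˢ X′ → i ∈ˢ X ⊎ i ≡ y
      cases i∈X′ with x∈p∪q⁻ X ⁅ y ⁆ i∈X′
      ... | inj₁ i∈X = inj₁ i∈X
      ... | inj₂ i∈y = inj₂ (x∈⁅y⁆⇒x≡y y i∈y)

      X⊆X′ : ∀ {i} → i ∈ˢ X → i ∈ˢ X′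
      X⊆X′ = p⊆p∪q ⁅ y ⁆

      y∈X′ : y ∈ˢ X′
      y∈X′ = x∈p∪q⁺ (inj₂ (x∈⁅x⁆ y))

      link-y : ∀ {i} → i ∈ˢ X → Adj T i y → Link i (label′ i) y (label′ y)
      link-y i∈X iy with only-neighbour i∈X iy
      ... | refl = subst₂ (λ q q′ → Link x q y q′) (sym (label′-X x∈X)) (sym label′-y) (proj₂ (proj₂ fresh))

      walk-X : ∀ {i j} → i ∈ˢ X → j ∈ˢ X → Star (λ u v → u ∈ˢ X′ × Adj T u v × v ∈ˢ X′) i j
      walk-X i∈X j∈X = Star.map (λ (u∈ , uv , v∈) → X⊆X′ u∈ , uv , X⊆X′ v∈) (joined _ _ i∈X j∈X)

    extended : Partial X′
    extended = record
      { label  = label′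
      ; root   = root
      ; root∈  = X⊆X′ root∈
      ; valid  = λ i∈ → valid′ (cases i∈)
      ; linked = λ i∈ j∈ → linked′ (cases i∈) (cases j∈)
      ; joined = λ _ _ i∈ j∈ → joined′ (cases i∈) (cases j∈)
      }
      where
      valid′ : ∀ {i} → i ∈ˢ X ⊎ i ≡ y → Valid i (label′ i)
      valid′ (inj₁ i∈X)  = subst (Valid _) (sym (label′-X i∈X)) (valid i∈X)
      valid′ (inj₂ refl) = subst (Valid y) (sym label′-y) (proj₁ (proj₂ fresh))

      linked′ : ∀ {i j} → i ∈ˢ X ⊎ i ≡ y → j ∈ˢ X ⊎ j ≡ y → Adj T i j → Linked label′ i j
      linked′ {i} {j} (inj₁ i∈X) (inj₁ j∈X) ij =
        subst₂ (λ q q′ → Link i q j q′ ⊎ Link j q′ i q) (sym (label′-X i∈X)) (sym (label′-X j∈X)) (linked i∈X j∈X ij)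
      linked′ (inj₁ i∈X)  (inj₂ refl) ij = inj₁ (link-y i∈X ij)
      linked′ (inj₂ refl) (inj₁ j∈X)  ij = inj₂ (link-y j∈X (adj-sym T ij))
      linked′ (inj₂ refl) (inj₂ refl) ij = ⊥-elim (adj-irrefl T refl ij)

      joined′ : ∀ {i j} → i ∈ˢ X ⊎ i ≡ y → j ∈ˢ X ⊎ j ≡ y → Star (λ u v → u ∈ˢ X′ × Adj T u v × v ∈ˢ X′) i j
      joined′ (inj₁ i∈X)  (inj₁ j∈X)  = walk-X i∈X j∈X
      joined′ (inj₁ i∈X)  (inj₂ refl) = walk-X i∈X x∈X ◅◅ ((X⊆X′ x∈X , xy , y∈X′) ◅ ε)
      joined′ (inj₂ refl) (inj₁ j∈X)  = (y∈X′ , adj-sym T xy , X⊆X′ x∈X) ◅ walk-X x∈X j∈X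
      joined′ (inj₂ refl) (inj₂ refl) = ε

    grows : X ⊂ˢ X′
    grows = X⊆X′ , y , y∈X′ , y∉X

  complete : ∀ {X} → Acc Subset._⊃_ X → Partial X →
    ∃[ label ] ((∀ i → Valid i (label i)) × (∀ i j → Adj T i j → Linked label i j))
  complete {X} (acc rec) S with any? (λ i → ¬? (i ∈? X))
  ... | yes (w , w∉X) =
    let x , y , x∈X , y∉X , xy = crossing T X (Partial.root∈ S) w∉X (IsTree.connected isTree _ w tt tt)
    in complete (rec (grows S x∈X y∉X xy)) (extended S x∈X y∉X xy)
  ... | no none = label , (λ i → valid (every i)) , λ i j → linked (every i) (every j)
    where
    open Partial S
    every : ∀ i → i ∈ˢ X
    every i with i ∈? X
    ... | yes i∈X = i∈X
    ... | no i∉X  = ⊥-elim (none (i , i∉X))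

  labelling : ∀ root {q} → Valid root q →
    ∃[ label ] ((∀ i → Valid i (label i)) × (∀ i j → Adj T i j → Linked label i j))
  labelling root {q} ok = complete (⊃-wellFounded ⁅ root ⁆) record
    -- Only the root belongs to the initial set; the labels elsewhere are placeholders.
    { label  = λ _ → q
    ; root   = root
    ; root∈  = x∈⁅x⁆ root
    ; valid  = λ i∈ → subst (λ i → Valid i q) (sym (x∈⁅y⁆⇒x≡y root i∈)) ok
    ; linked = λ i∈ j∈ ij →
        ⊥-elim (adj-irrefl T (trans (x∈⁅y⁆⇒x≡y root i∈) (sym (x∈⁅y⁆⇒x≡y root j∈))) ij)
    ; joined = λ i j i∈ j∈ →
        subst (Star _ i) (trans (x∈⁅y⁆⇒x≡y root i∈) (sym (x∈⁅y⁆⇒x≡y root j∈))) ε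
    }

-- Finite sets and degrees

-- Induction removes the image of the first element from `q`. The map takes a membership proof
-- because in `bijective-degrees` a preimage is available only for a neighbour.
injection-≤ : ∀ {n m} (p : Subset n) (q : Subset m) (f : ∀ x → x ∈ˢ p → Fin m) →
  (∀ x x∈p → f x x∈p ∈ˢ q) → (∀ {x y} x∈p y∈p → f x x∈p ≡ f y y∈p → x ≡ y) → ∣ p ∣ ≤ ∣ q ∣
injection-≤ []          q f f∈ inj = z≤n
injection-≤ (false ∷ p) q f f∈ inj =
  injection-≤ p q (λ x x∈p → f (suc x) (there x∈p)) (λ x x∈p → f∈ (suc x) (there x∈p))
    (λ x∈p y∈p eq → Finₚ.suc-injective (inj (there x∈p) (there y∈p) eq))
injection-≤ (true ∷ p) q f f∈ inj = ≤-trans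
  (s≤s (injection-≤ p (q -ˢ f zero here) (λ x x∈p → f (suc x) (there x∈p))
    (λ x x∈p → x∈p∧x≢y⇒x∈p-y (f∈ (suc x) (there x∈p)) (λ eq → 0≢suc (inj here (there x∈p) (sym eq))))
    (λ x∈p y∈p eq → Finₚ.suc-injective (inj (there x∈p) (there y∈p) eq))))
  (x∈p⇒∣p-x∣<∣p∣ (f∈ zero here))
  where
  0≢suc : ∀ {n} {x : Fin n} → Fin.zero ≢ suc x
  0≢suc ()

-- The length is the bound `k` rather than the size of the set, so that all scopes are equally long;
-- spare places hold the default. The map `g` lets the recursion pass to the tail of the index set.
enumerate : ∀ {A : Set} {n} (p : Subset n) {k} → ∣ p ∣ ≤ k → (g : Fin n → A) → A →
  Σ[ f ∈ (Fin k → A) ] (∀ {x} → x ∈ˢ p → ∃[ a ] f a ≡ g x)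
enumerate []          _       g a₀ = (λ _ → a₀) , λ ()
enumerate (false ∷ p) p≤k     g a₀ with enumerate p p≤k (g ∘ suc) a₀
... | f , onto = f , λ { (there x∈p) → onto x∈p }
enumerate (true ∷ p)  (s≤s p≤k) g a₀ with enumerate p p≤k (g ∘ suc) a₀
... | f , onto = (λ { zero → g zero ; (suc a) → f a }) ,
  λ { here → zero , refl ; (there x∈p) → suc (proj₁ (onto x∈p)) , proj₂ (onto x∈p) }

≤-maximum : ∀ {n} (f : Fin n → ℕ) i → f i ≤ maximum f
≤-maximum f i = v≤max⁺ 0 (List.tabulate f) (inj₂ (Any.tabulate⁺ i ≤-refl))

T⇒≡ : ∀ {b} → T b → b ≡ true
T⇒≡ {true} _ = refl

∈-N : ∀ G {u v} → Adj G u v → v ∈ˢ N G u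
∈-N G {u} {v} uv = lookup⇒[]= v (N G u) (trans (lookup∘tabulate (adj G u) v) (T⇒≡ uv))

N-∈ : ∀ G {u v} → v ∈ˢ N G u → Adj G u v
N-∈ G {u} {v} v∈ = subst T (trans (sym ([]=⇒lookup v∈)) (lookup∘tabulate (adj G u) v)) tt

Nbr-≡ : ∀ {G u} {x y : Nbr G u} → proj₁ x ≡ proj₁ y → x ≡ y
Nbr-≡ {x = v , _} refl = cong (v ,_) (T-irrelevant _ _)

module _ {G H : Graph} (φ : Hom G H) where
  open Hom φ

  SameDegrees : Set
  SameDegrees = ∀ u → ∣ N G u ∣ ≡ ∣ N H (map u) ∣

  locally-injective : LocallyInjective φ → ∀ {u v v′} → Adj G u v → Adj G u v′ → map v ≡ map v′ → v ≡ v′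
  locally-injective inj {u} uv uv′ eq = cong proj₁ (inj u {_ , uv} {_ , uv′} (Nbr-≡ {H} eq))

  degree-≤ : LocallyInjective φ → ∀ u → ∣ N G u ∣ ≤ ∣ N H (map u) ∣
  degree-≤ inj u = injection-≤ (N G u) (N H (map u)) (λ v _ → map v)
    (λ v v∈ → ∈-N H (preserve (N-∈ G v∈)))
    (λ v∈ v′∈ → locally-injective inj (N-∈ G v∈) (N-∈ G v′∈))

  bijective-degrees : LocallyBijective φ → SameDegrees
  bijective-degrees bij u = ≤-antisym (degree-≤ (λ u → proj₁ (bij u)) u)
    (injection-≤ (N H (map u)) (N G u)
      (λ y y∈ → proj₁ (pre y∈)) (λ y y∈ → ∈-N G (proj₂ (pre y∈)))
      (λ y∈ z∈ eq → trans (sym (pre-≡ y∈)) (trans (cong map eq) (pre-≡ z∈))))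
    where
    pre : ∀ {y} → y ∈ˢ N H (map u) → Nbr G u
    pre y∈ = proj₁ (proj₂ (bij u) (_ , N-∈ H y∈))
    pre-≡ : ∀ {y} (y∈ : y ∈ˢ N H (map u)) → map (proj₁ (pre y∈)) ≡ y
    pre-≡ y∈ = cong proj₁ (proj₂ (proj₂ (bij u) (_ , N-∈ H y∈)) refl)

  -- A neighbour `y` of the image without a preimage would leave an injection into a set smaller by
  -- one, against the equality of degrees.
  degrees-bijective : LocallyInjective φ → SameDegrees → LocallyBijective φ
  degrees-bijective inj same u = inj u , surjective
    where
    surjective : ∀ y → ∃[ x ] (∀ {z} → z ≡ x → restrict u z ≡ y)
    surjective (y , uy) with any? (λ v → T? (adj G u v) ×-dec (map v Fin.≟ y))
    ... | yes (v , uv , refl) = (v , uv) , λ { refl → Nbr-≡ {H} refl }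
    ... | no none = ⊥-elim (<⇒≱ (x∈p⇒∣p-x∣<∣p∣ (∈-N H uy))
      (subst (_≤ ∣ N H (map u) -ˢ y ∣) (same u)
        (injection-≤ (N G u) (N H (map u) -ˢ y) (λ v _ → map v)
          (λ v v∈ → x∈p∧x≢y⇒x∈p-y (∈-N H (preserve (N-∈ G v∈))) (λ eq → none (v , N-∈ G v∈ , eq)))
          (λ v∈ v′∈ → locally-injective inj (N-∈ G v∈) (N-∈ G v′∈)))))

onℕ : ∀ {k} → (Fin k → ℕ) → ℕ → ℕ
onℕ {zero}  f _       = 0
onℕ {suc k} f zero    = f zero
onℕ {suc k} f (suc x) = onℕ (f ∘ suc) x

onℕ-toℕ : ∀ {k} (f : Fin k → ℕ) i → onℕ f (toℕ i) ≡ f i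
onℕ-toℕ f zero    = refl
onℕ-toℕ f (suc i) = onℕ-toℕ (f ∘ suc) i

onℕ-< : ∀ {k b} (f : Fin k → ℕ) → (∀ i → f i < b) → ∀ x → x < k → onℕ f x < b
onℕ-< {suc k} f f< zero    _         = f< zero
onℕ-< {suc k} f f< (suc x) (s≤s x<k) = onℕ-< (f ∘ suc) (f< ∘ suc) x x<k

Σ<-front : ∀ n (f : ℕ → ℕ) → Σ< (suc n) f ≡ f 0 + Σ< n (f ∘ suc)
Σ<-front zero    f = refl
Σ<-front (suc n) f = begin
  f (suc n) + Σ< (suc n) f                ≡⟨ cong (f (suc n) +_) (Σ<-front n f) ⟩
  f (suc n) + (f 0 + Σ< n (f ∘ suc))      ≡⟨ sym (+-assoc (f (suc n)) (f 0) _) ⟩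
  f (suc n) + f 0 + Σ< n (f ∘ suc)        ≡⟨ cong (_+ Σ< n (f ∘ suc)) (+-comm (f (suc n)) (f 0)) ⟩
  f 0 + f (suc n) + Σ< n (f ∘ suc)        ≡⟨ +-assoc (f 0) (f (suc n)) _ ⟩
  f 0 + Σ< (suc n) (f ∘ suc)              ∎
  where open ≡-Reasoning

Σ<-cardinality : ∀ {n} (f : Fin n → Bool) (g : ℕ → Bool) → (∀ i → g (toℕ i) ≡ f i) →
                 Σ< n (λ y → b2n (g y)) ≡ ∣ Vec.tabulate f ∣
Σ<-cardinality {zero}  f g eq = refl
Σ<-cardinality {suc n} f g eq = trans (Σ<-front n (λ y → b2n (g y)))
  (trans (cong₂ _+_ (cong b2n (eq zero)) (Σ<-cardinality (f ∘ suc) (g ∘ suc) (eq ∘ suc))) (head (f zero)))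
  where
  head : ∀ b → b2n b + ∣ Vec.tabulate (f ∘ suc) ∣ ≡ ∣ b ∷ Vec.tabulate (f ∘ suc) ∣
  head true  = refl
  head false = refl

pred-≤ : ∀ x {t} → ℤ.pred (ℤ.+ x) ℤ.≤ ℤ.+ t → x ≤ suc t
pred-≤ zero    _ = z≤n
pred-≤ (suc x) (ℤ.+≤+ x≤t) = s≤s x≤t

-- Tree decompositions and constraint networks

module _ {G : Graph} (D : TreeDecomposition G) where
  open TreeDecomposition D

  Near : Vertex tree → Vertex G → Set
  Near i v = ∃[ u ] (u ∈ˢ bag i × (u ≡ v ⊎ Adj G u v))

  home : Vertex G → Vertex tree
  home v = proj₁ (covers-vertices v)

  home-near : ∀ v → Near (home v) v
  home-near v = v , proj₂ (covers-vertices v) , inj₁ refl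

  -- From a node containing a neighbour `u` of `v`, the walk stays in the subtree of `u` up to a
  -- node covering the edge `uv`, and then in the subtree of `v`; all these nodes are near `v`.
  near-walk : ∀ {i v} → Near i v → Star (λ i j → Near i v × Adj tree i j × Near j v) i (home v)
  near-walk {i} {v} (_ , v∈i , inj₁ refl) =
    Star.map (λ (v∈i , ij , v∈j) → (v , v∈i , inj₁ refl) , ij , (v , v∈j , inj₁ refl))
      (connected v i (home v) v∈i (proj₂ (covers-vertices v)))
  near-walk {i} {v} (u , u∈i , inj₂ uv) with covers-edges u v uv
  ... | j , u∈j , v∈j =
    Star.map (λ (u∈i , ij , u∈j) → (u , u∈i , inj₂ uv) , ij , (u , u∈j , inj₂ uv)) (connected u i j u∈i u∈j)
    ◅◅ near-walk (v , v∈j , inj₁ refl)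

module Scopes {G : Graph} {t d : ℕ} (D : TreeDecomposition G) (width≤t : width D ℤ.≤ ℤ.+ t)
              (degree≤d : ∀ u → ∣ N G u ∣ ≤ d) (v₀ : Vertex G) where
  open TreeDecomposition D

  private
    inBag : ∀ i → Σ[ f ∈ (Fin (suc t) → Vertex G) ] (∀ {v} → v ∈ˢ bag i → ∃[ a ] f a ≡ v)
    inBag i = enumerate (bag i) (≤-trans (≤-maximum (λ i → ∣ bag i ∣) i) (pred-≤ _ width≤t)) id v₀

    nearby : ∀ u → Σ[ f ∈ (Fin d → Vertex G) ] (∀ {v} → v ∈ˢ N G u → ∃[ a ] f a ≡ v)
    nearby u = enumerate (N G u) (degree≤d u) id v₀

    around : Vertex G → Fin (suc d) → Vertex G
    around u zero    = u
    around u (suc b) = proj₁ (nearby u) b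

  -- A position encodes a place in the bag together with a place in the closed neighbourhood of the
  -- vertex found there.
  scope : Vertex tree → Fin (suc t * suc d) → Vertex G
  scope i x = around (proj₁ (inBag i) (proj₁ (remQuot (suc d) x))) (proj₂ (remQuot {suc t} (suc d) x))

  scope-onto : ∀ {i v} → Near D i v → ∃[ x ] scope i x ≡ v
  scope-onto {i} {v} (u , u∈i , uv) with proj₂ (inBag i) u∈i
  ... | a , refl = combine a (proj₁ (index uv)) ,
    trans (cong (λ (a , b) → around (proj₁ (inBag i) a) b) (remQuot-combine {suc t} a (proj₁ (index uv)))) (proj₂ (index uv))
    where
    index : u ≡ v ⊎ Adj G u v → ∃[ b ] around u b ≡ v
    index (inj₁ u≡v) = zero , u≡v
    index (inj₂ uv)  = let b , eq = proj₂ (nearby u) (∈-N G uv) in suc b , eq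

-- A scope may list vertices that are not near its node: they only add
-- constraints, so nothing is lost by padding.
module Solve {G : Graph} (D : TreeDecomposition G) {κ m : ℕ}
  (scope : Vertex (TreeDecomposition.tree D) → Fin κ → Vertex G)
  (scope-onto : ∀ {i v} → Near D i v → ∃[ x ] scope i x ≡ v)
  (Rel : ℕ → ℕ → ℕ → ℕ → Set)
  (functional : ∀ {v h v′ h′} → Rel v h v′ h′ → v ≡ v′ → h ≡ h′)
  (Good : ℕ → ℕ → Set)
  (supported : ∀ {p q} → p < order G ^ κ → q < m ^ κ → Good p q → ∀ p′ → p′ < order G ^ κ →
    ∃[ q′ ] (q′ < m ^ κ × Good p′ q′ × (∀ a → a < κ → ∀ b → b < κ →
      Rel (digit (order G) a p) (digit m a q) (digit (order G) b p′) (digit m b q′))))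
  (nonempty : ∀ p → p < order G ^ κ → ∃[ q ] (q < m ^ κ × Good p q))
  (v₀ : Vertex G) where

  open TreeDecomposition D

  private
    n = order G

  Compatible : (p q p′ q′ : ℕ) → Set
  Compatible p q p′ q′ = ∀ a → a < κ → ∀ b → b < κ →
    Rel (digit n a p) (digit m a q) (digit n b p′) (digit m b q′)

  scopeCode : Vertex tree → ℕ
  scopeCode i = code n κ (onℕ (toℕ ∘ scope i))

  scopeCode-< : ∀ i → scopeCode i < n ^ κ
  scopeCode-< i = code-< κ _ (onℕ-< (toℕ ∘ scope i) (λ x → toℕ<n (scope i x)))

  scopeCode-digit : ∀ i x → digit n (toℕ x) (scopeCode i) ≡ toℕ (scope i x)
  scopeCode-digit i x = trans
    (digit-code κ _ (toℕ x) (toℕ<n x) (onℕ-< (toℕ ∘ scope i) (λ x → toℕ<n (scope i x))))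
    (onℕ-toℕ (toℕ ∘ scope i) x)

  Valid : Vertex tree → ℕ → Set
  Valid i q = q < m ^ κ × Good (scopeCode i) q

  Link : Vertex tree → ℕ → Vertex tree → ℕ → Set
  Link i q j q′ = Compatible (scopeCode i) q (scopeCode j) q′

  extend : ∀ {i q} → Valid i q → ∀ j → ∃[ q′ ] (Valid j q′ × Link i q j q′)
  extend {i} (q< , good) j =
    let q′ , q′< , good′ , link = supported (scopeCode-< i) q< good (scopeCode j) (scopeCode-< j)
    in q′ , (q′< , good′) , link

  -- The entry is supported on its own tuple too, by some `q′`. Each vertex of the tuple equals
  -- itself, so `functional` makes the digits of `q′` those of `q`, and the link to `q′` is a link
  -- to `q`.
  link-self : ∀ {i q} → Valid i q → Link i q i q
  link-self {i} valid a a<κ b b<κ with extend valid i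
  ... | q′ , _ , link = subst (Rel _ _ _) (sym (functional (link b b<κ b b<κ) refl)) (link a a<κ b b<κ)

  private
    labelled = Labelling.labelling isTree Valid Link extend (home D v₀)
      (proj₂ (nonempty (scopeCode (home D v₀)) (scopeCode-< (home D v₀))))

    label : Vertex tree → ℕ
    label = proj₁ labelled

    valid : ∀ i → Valid i (label i)
    valid = proj₁ (proj₂ labelled)

  value : ∀ i → Fin κ → ℕ
  value i x = digit m (toℕ x) (label i)

  value-< : ∀ i x → value i x < m
  value-< i x = digit-< (toℕ x) (label i) (base>0 (proj₁ (valid i)) (toℕ<n x))

  rel-from-link : ∀ {i j} → Link i (label i) j (label j) → ∀ x y →
    Rel (toℕ (scope i x)) (value i x) (toℕ (scope j y)) (value j y)
  rel-from-link {i} {j} link x y = subst₂ (λ v v′ → Rel v (value i x) v′ (value j y))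
    (scopeCode-digit i x) (scopeCode-digit j y) (link (toℕ x) (toℕ<n x) (toℕ y) (toℕ<n y))

  value-self : ∀ {i x y} → scope i x ≡ scope i y → value i x ≡ value i y
  value-self {i} {x} {y} eq = functional (rel-from-link (link-self (valid i)) x y) (cong toℕ eq)

  value-adj : ∀ {i j x y} → Adj tree i j → scope i x ≡ scope j y → value i x ≡ value j y
  value-adj {i} {j} {x} {y} ij eq with proj₂ (proj₂ labelled) i j ij
  ... | inj₁ link = functional (rel-from-link link x y) (cong toℕ eq)
  ... | inj₂ link = sym (functional (rel-from-link link y x) (cong toℕ (sym eq)))

  -- `v` is near every node of the walk, hence listed in each scope on the way, and adjacent scopes
  -- agree on it.
  value-walk : ∀ {i j x y v} → Star (λ i j → Near D i v × Adj tree i j × Near D j v) i j →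
    scope i x ≡ v → scope j y ≡ v → value i x ≡ value j y
  value-walk ε eq eq′ = value-self (trans eq (sym eq′))
  value-walk ((_ , ij , near) ◅ walk) eq eq′ with scope-onto near
  ... | z , eq″ = trans (value-adj ij (trans eq (sym eq″))) (value-walk walk eq″ eq′)

  private
    homeIndex : ∀ v → ∃[ x ] scope (home D v) x ≡ v
    homeIndex v = scope-onto (home-near D v)

  solution : Vertex G → Fin m
  solution v = fromℕ< (value-< (home D v) (proj₁ (homeIndex v)))

  value-solution : ∀ {i x v} → Near D i v → scope i x ≡ v → value i x ≡ toℕ (solution v)
  value-solution {v = v} near eq =
    trans (value-walk (near-walk D near) eq (proj₂ (homeIndex v))) (sym (toℕ-fromℕ< _))

  solution-rel : ∀ {i v v′} → Near D i v → Near D i v′ →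
    Rel (toℕ v) (toℕ (solution v)) (toℕ v′) (toℕ (solution v′))
  solution-rel {i} near near′ with scope-onto near | scope-onto near′
  ... | x , refl | y , refl = subst₂ (λ h h′ → Rel _ h _ h′) (value-solution near refl) (value-solution near′ refl)
    (rel-from-link (link-self (valid i)) x y)

-- Correctness

Locally : Bool → ∀ {G H} → Hom G H → Set
Locally β φ = LocallyInjective φ × (T β → SameDegrees φ)

Solvable : Bool → Graph × Graph → Set
Solvable β (G , H) = Σ[ φ ∈ Hom G H ] Locally β φ

bounded-degree : ∀ {G d} → maxDegree G ≤ d → ∀ u → ∣ N G u ∣ ≤ d
bounded-degree {G} G≤d u = ≤-trans (≤-maximum (λ u → ∣ N G u ∣) u) G≤d

module Correctness (β : Bool) (κ d : ℕ) (G H : Graph) where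
  open Instance β κ d G H
  open Consistency β κ d G H
  open Assignments β κ d G H

  adjG-≡ : ∀ u v → get w (posG n (toℕ u) (toℕ v)) ≡ adj G u v
  adjG-≡ u v = get-encoding-adj G u v

  adjH-≡ : ∀ u v → get w (posH n m (toℕ u) (toℕ v)) ≡ adj H u v
  adjH-≡ u v = trans (w-H (posG m (toℕ u) (toℕ v))) (get-encoding-adj H u v)

  degG-≡ : ∀ v → degG w n (toℕ v) ≡ ∣ N G v ∣
  degG-≡ v = Σ<-cardinality (adj G v) (λ y → get w (posG n (toℕ v) y)) (adjG-≡ v)

  degH-≡ : ∀ h → degH w n m (toℕ h) ≡ ∣ N H h ∣
  degH-≡ h = Σ<-cardinality (adj H h) (λ y → get w (posH n m (toℕ h) y)) (adjH-≡ h)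

  RelAt : (Vertex G → Vertex H) → Vertex G → Vertex G → Set
  RelAt f v v′ = Rel β w n m (toℕ v) (toℕ (f v)) (toℕ v′) (toℕ (f v′))

  module _ (φ : Hom G H) (loc : Locally β φ) where
    open Hom φ

    hom-rel : ∀ v v′ → RelAt map v v′
    hom-rel v v′ =
      (λ eq → cong (toℕ ∘ map) (toℕ-injective eq)) ,
      (λ vv′ → subst T (sym (adjH-≡ (map v) (map v′))) (preserve (subst T (adjG-≡ v v′) vv′))) ,
      (λ u u<n uv uv′ eq → cong toℕ (locally-injective φ (proj₁ loc)
        (subst T (adjG-≡ (fromℕ< u<n) v) (subst (λ x → T (get w (posG n x (toℕ v)))) (sym (toℕ-fromℕ< u<n)) uv))
        (subst T (adjG-≡ (fromℕ< u<n) v′) (subst (λ x → T (get w (posG n x (toℕ v′)))) (sym (toℕ-fromℕ< u<n)) uv′))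
        (toℕ-injective eq))) ,
      degree β (proj₂ loc)
      where
      degree : ∀ β → (T β → SameDegrees φ) → DegreeOK β w n m (toℕ v) (toℕ (map v))
      degree true  same = trans (degG-≡ v) (trans (same tt v) (sym (degH-≡ (map v))))
      degree false _    = z≤n

    private
      Φ : ℕ → ℕ
      Φ = onℕ (toℕ ∘ map)

    extended-rel : ∀ v v′ → v < n → v′ < n → Rel β w n m v (Φ v) v′ (Φ v′)
    extended-rel v v′ v<n v′<n =
      subst₂ (λ x y → Rel β w n m x (Φ x) y (Φ y)) (toℕ-fromℕ< v<n) (toℕ-fromℕ< v′<n)
        (subst₂ (λ h h′ → Rel β w n m (toℕ (fromℕ< v<n)) h (toℕ (fromℕ< v′<n)) h′)
          (sym (onℕ-toℕ (toℕ ∘ map) (fromℕ< v<n))) (sym (onℕ-toℕ (toℕ ∘ map) (fromℕ< v′<n)))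
          (hom-rel (fromℕ< v<n) (fromℕ< v′<n)))

    entries-survive : ∀ p → p < n ^ κ → ∃[ q ] (q < m ^ κ × Alive R p q)
    entries-survive p p< = image Φ Φ< extended-rel p , image-< Φ Φ< extended-rel p< , image-alive Φ Φ< extended-rel p<
      where
      Φ< : ∀ v → v < n → Φ v < m
      Φ< = onℕ-< (toℕ ∘ map) (λ v → toℕ<n (map v))

  module _ (f : Vertex G → Vertex H)
           (rel : ∀ u {v v′} → u ≡ v ⊎ Adj G u v → u ≡ v′ ⊎ Adj G u v′ → RelAt f v v′) where

    -- Only pairs inside one closed neighbourhood are used: an edge `uv` in that of `u`, two
    -- neighbours of `u` for injectivity, and a vertex with itself for its degree.
    rel-hom : Solvable β (G , H)
    rel-hom = φ , injective , same β (λ v → proj₂ (proj₂ (proj₂ (rel v (inj₁ refl) (inj₁ refl)))))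
      where
      φ : Hom G H
      φ = record
        { map      = f
        ; preserve = λ {u} {v} uv → subst T (adjH-≡ (f u) (f v))
            (proj₁ (proj₂ (rel u (inj₁ refl) (inj₂ uv))) (subst T (sym (adjG-≡ u v)) uv))
        }
      injective : LocallyInjective φ
      injective u {v , uv} {v′ , uv′} eq = Nbr-≡ {G} (toℕ-injective
        (proj₁ (proj₂ (proj₂ (rel u (inj₂ uv) (inj₂ uv′)))) (toℕ u) (toℕ<n u)
          (subst T (sym (adjG-≡ u v)) uv) (subst T (sym (adjG-≡ u v′)) uv′) (cong (toℕ ∘ proj₁) eq)))
      same : ∀ β → (∀ v → DegreeOK β w n m (toℕ v) (toℕ (f v))) → T β → SameDegrees φ
      same true deg _ v = trans (sym (degG-≡ v)) (trans (deg v) (degH-≡ (f v)))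

  -- Treated apart because there is no vertex to pad the scopes with or to start the labelling from.
  no-vertices : n ≡ 0 → Solvable β (G , H)
  no-vertices n≡0 = rel-hom (λ v → ⊥-elim (none v)) (λ u → ⊥-elim (none u))
    where
    none : Vertex G → ⊥
    none v = n≮0 (subst (toℕ v <_) n≡0 (toℕ<n v))

  entries-solvable : (D : TreeDecomposition G)
    (scope : Vertex (TreeDecomposition.tree D) → Fin κ → Vertex G) →
    (∀ {i v} → Near D i v → ∃[ x ] scope i x ≡ v) →
    (∀ p → p < n ^ κ → ∃[ q ] (q < m ^ κ × Alive R p q)) → Vertex G → Solvable β (G , H)
  entries-solvable D scope scope-onto survive v₀ = rel-hom solution
    (λ u uv uv′ → solution-rel {home D u} (u , proj₂ (covers-vertices u) , uv) (u , proj₂ (covers-vertices u) , uv′))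
    where
    open TreeDecomposition D
    open Solve D scope scope-onto (Rel β w n m) (λ r → proj₁ r) (Alive R) alive-supported survive v₀

module _ (β : Bool) (t d : ℕ) where
  private
    κ = suc t * suc d

  consistency-correct : ∀ x → BoundedInstance t d x →
    Reflects (Solvable β x) (result (consistency β κ d) (encodePair x))
  consistency-correct (G , H) ((_ , isTreewidth , w≤t) , G≤d∨H≤d) = reflects-⇔ sound complete result-reflects
    where
    open Instance β κ d G H
    open Consistency β κ d G H
    open Correctness β κ d G H

    sound : (∀ v → v < n → degG w n v ≤ d) × (∀ p → p < n ^ κ → ∃[ q ] (q < m ^ κ × Alive R p q)) → Solvable β (G , H)
    sound (deg≤d , survive) = decide (n ≟ 0)
      where
      D = proj₁ (IsTreewidth.attained isTreewidth)
      width≤t : width D ℤ.≤ ℤ.+ t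
      width≤t = subst (ℤ._≤ ℤ.+ t) (sym (proj₂ (IsTreewidth.attained isTreewidth))) w≤t
      -- Taken from the verdict, since the promise may bound the degrees of `H` only.
      degree≤d : ∀ u → ∣ N G u ∣ ≤ d
      degree≤d u = ≤-trans (≤-reflexive (sym (degG-≡ u))) (deg≤d (toℕ u) (toℕ<n u))
      decide : Dec (n ≡ 0) → Solvable β (G , H)
      decide (yes n≡0) = no-vertices n≡0
      decide (no n≢0)  = entries-solvable D (scope D width≤t degree≤d v₀) (scope-onto D width≤t degree≤d v₀) survive v₀
        where
        open Scopes
        v₀ : Vertex G
        v₀ = fromℕ< (n≢0⇒n>0 n≢0)

    complete : Solvable β (G , H) →
      (∀ v → v < n → degG w n v ≤ d) × (∀ p → p < n ^ κ → ∃[ q ] (q < m ^ κ × Alive R p q))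
    complete (φ , loc) =
      (λ v v<n → subst (λ x → degG w n x ≤ d) (toℕ-fromℕ< v<n)
        (≤-trans (≤-reflexive (degG-≡ (fromℕ< v<n))) (degree≤d G≤d∨H≤d (fromℕ< v<n)))) ,
      entries-survive φ loc
      where
      degree≤d : maxDegree G ≤ d ⊎ maxDegree H ≤ d → ∀ u → ∣ N G u ∣ ≤ d
      degree≤d (inj₁ G≤d) u = bounded-degree {G} G≤d u
      degree≤d (inj₂ H≤d) u = ≤-trans (degree-≤ φ (proj₁ loc) u) (bounded-degree {H} H≤d (Hom.map φ u))

solvable-true : ∀ x → Solvable true x → LBHom x
solvable-true x (φ , inj , same) = φ , degrees-bijective φ inj (same tt)

true-solvable : ∀ x → LBHom x → Solvable true x
true-solvable x (φ , bij) = φ , (λ u → proj₁ (bij u)) , λ _ → bijective-degrees φ bij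

theorem3 : (t d : ℕ) →
    PolyTimeDecidable encodePair (BoundedInstance t d) LBHom
    × PolyTimeDecidable encodePair (BoundedInstance t d) LIHom
theorem3 t d =
  scheme-decides (consistency true (suc t * suc d) d) (λ x x∈P →
    reflects-⇔ (solvable-true x) (true-solvable x) (consistency-correct true t d x x∈P)) ,
  scheme-decides (consistency false (suc t * suc d) d) (λ x x∈P →
    reflects-⇔ (λ (φ , inj , _) → φ , inj) (λ (φ , inj) → φ , inj , λ ()) (consistency-correct false t d x x∈P))
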